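{- There is no Cameron–Liebler line class in $PG(3,4)$ with parameter $x\in\{4,5,6,8\}$.
   Context: Let $q$ be a prime power. A set $\mathcal L$ of lines of the projective space $PG(3,q)$ is a Cameron–Liebler line class with parameter $x$ (an integer) if for every line $l$ of $PG(3,q)$, $$|\{m\in\mathcal L\setminus\{l\}: m \text{ meets } l\}| = (q+1)x+(q^2-1)\chi_{\mathcal L}(l),$$ where $\chi_{\mathcal L}$ is the characteristic function of $\mathcal L$ on the set of lines. -}

module Defs where

open import Data.Bool using (Bool; true; false; _∧_; _∨_; not; if_then_else_)
open import Data.Nat using (ℕ)
open import Data.Integer using (ℤ; +_) renaming (_+_ to _+ℤ_; _*_ to _*ℤ_)
open import Data.List using (List; []; _∷_; map; concatMap; filter; length)
open import Data.Bool.ListAction using (any)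
open import Relation.Binary.PropositionalEquality using (_≡_)
open import Relation.Nullary.Decidable using (Dec)
open import Data.Bool using (T)
open import Relation.Nullary.Decidable using (yes; no)
open import Data.Bool.Properties using (T?)

-- The field GF(4) = {0, 1, w, w2} with w² = w + 1 (characteristic 2).

data GF4 : Set where
  o i w w2 : GF4

_⊕_ : GF4 → GF4 → GF4
o  ⊕ y  = y
x  ⊕ o  = x
i  ⊕ i  = o
i  ⊕ w  = w2
i  ⊕ w2 = w
w  ⊕ i  = w2
w  ⊕ w  = o
w  ⊕ w2 = i
w2 ⊕ i  = w
w2 ⊕ w  = i
w2 ⊕ w2 = o

_⊗_ : GF4 → GF4 → GF4
o  ⊗ _  = o
_  ⊗ o  = o
i  ⊗ y  = y
x  ⊗ i  = x
w  ⊗ w  = w2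
w  ⊗ w2 = i
w2 ⊗ w  = i
w2 ⊗ w2 = w

_==F_ : GF4 → GF4 → Bool
o  ==F o  = true
i  ==F i  = true
w  ==F w  = true
w2 ==F w2 = true
_  ==F _  = false

allGF4 : List GF4
allGF4 = o ∷ i ∷ w ∷ w2 ∷ []

data V4 : Set where
  v4 : GF4 → GF4 → GF4 → GF4 → V4

_+V_ : V4 → V4 → V4
v4 a b c d +V v4 a' b' c' d' = v4 (a ⊕ a') (b ⊕ b') (c ⊕ c') (d ⊕ d')

_·V_ : GF4 → V4 → V4
k ·V v4 a b c d = v4 (k ⊗ a) (k ⊗ b) (k ⊗ c) (k ⊗ d)

_==V_ : V4 → V4 → Bool
v4 a b c d ==V v4 a' b' c' d' = (a ==F a') ∧ (b ==F b') ∧ (c ==F c') ∧ (d ==F d')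

-- Lines of PG(3,4) = 2-dimensional subspaces of GF(4)^4, each represented
-- uniquely by its reduced row echelon basis (one constructor per pair of
-- pivot columns, arguments = free entries).  There are 256+64+16+16+4+1 = 357.

data Line : Set where
  l01 : GF4 → GF4 → GF4 → GF4 → Line
  l02 : GF4 → GF4 → GF4 → Line
  l03 : GF4 → GF4 → Line
  l12 : GF4 → GF4 → Line
  l13 : GF4 → Line
  l23 : Line

row₁ row₂ : Line → V4
row₁ (l01 a b c d) = v4 i o a b
row₁ (l02 a b c)   = v4 i a o b
row₁ (l03 a b)     = v4 i a b o
row₁ (l12 a b)     = v4 o i o a
row₁ (l13 a)       = v4 o i a o
row₁ l23           = v4 o o i o
row₂ (l01 a b c d) = v4 o i c d
row₂ (l02 a b c)   = v4 o o i c
row₂ (l03 a b)     = v4 o o o i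
row₂ (l12 a b)     = v4 o o i b
row₂ (l13 a)       = v4 o o o i
row₂ l23           = v4 o o o i

allLines : List Line
allLines =
     concatMap (λ a → concatMap (λ b → concatMap (λ c → map (l01 a b c) allGF4) allGF4) allGF4) allGF4
  Data.List.++ (concatMap (λ a → concatMap (λ b → map (l02 a b) allGF4) allGF4) allGF4
  Data.List.++ (concatMap (λ a → map (l03 a) allGF4) allGF4
  Data.List.++ (concatMap (λ a → map (l12 a) allGF4) allGF4
  Data.List.++ (map l13 allGF4
  Data.List.++ (l23 ∷ [])))))

-- equality of lines (the RREF representation is canonical)
_==L_ : Line → Line → Bool
l ==L m = (row₁ l ==V row₁ m) ∧ (row₂ l ==V row₂ m)

comb : Line → GF4 → GF4 → V4
comb l a b = (a ·V row₁ l) +V (b ·V row₂ l)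

isZero : GF4 → GF4 → Bool
isZero a b = (a ==F o) ∧ (b ==F o)

meets : Line → Line → Bool
meets l m =
  any (λ a → any (λ b → not (isZero a b) ∧
    any (λ c → any (λ d → comb l a b ==V comb m c d) allGF4) allGF4) allGF4) allGF4

-- Sets of lines (finite, so given by characteristic functions) and
-- Cameron–Liebler line classes in PG(3,q), q = 4.

LineSet : Set
LineSet = Line → Bool

χ : LineSet → Line → ℕ
χ L l = if L l then 1 else 0

meetCount : LineSet → Line → ℕ
meetCount L l = length (filter (λ m → T? (L m ∧ not (m ==L l) ∧ meets m l)) allLines)

q : ℕ
q = 4

IsCameronLieblerLineClass : LineSet → ℤ → Set
IsCameronLieblerLineClass L x =
  (l : Line) → + meetCount L l ≡ (+ (q Data.Nat.+ 1)) *ℤ x +ℤ + (q Data.Nat.* q Data.Nat.∸ 1) *ℤ + χ L l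

module Submission where

-- For a class L with parameter x let n(p) and N(π) be the numbers of lines of L through the point p and in
-- the plane π.  Counting gives n(p) + N(π) = x + 5 |L ∩ pencil(p, π)| for p ∈ π, gives 5x + 20 χ(l) for the sum
-- of n over the points of a line l and of N over the planes on l, and, for l ∉ L, gives 10x² + 20x for the sum of
-- the squares of these ten numbers.  By the first identity n ≡ c and N ≡ c′ modulo 5 with constant c and c′; the
-- quadratic identity modulo 25 then excludes x = 4 and x = 8, and leaves (c, c′) = (0, 0) for x = 5 and (0, 1) or
-- (1, 0), which are dual, for x = 6.  Write n = c + 5m and N = c′ + 5m′.  In these cases the identities for a line
-- outside L are so restrictive that there are a point p with m(p) = 0 and a plane π with m′(π) = 0, and that some
-- line through p then carries weights m which violate the quadratic identity.  The elementary incidence properties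
-- of PG(3,4) are verified by enumerating its 85 points, 85 planes and 357 lines.

open import Defs
open import Data.Bool using (Bool; true; false; _∧_; not; if_then_else_)
open import Data.Bool.ListAction using (any)
open import Data.Bool.Properties using (T?; T-≡)
open import Data.Empty using (⊥; ⊥-elim)
open import Data.List using (List; []; _∷_; _++_; map; concatMap; filterᵇ; length; upTo)
open import Data.List.Membership.Propositional using (_∈_; lose)
open import Data.List.Membership.Propositional.Properties
  using (∈-++⁺ˡ; ∈-++⁺ʳ; ∈-map⁺; ∈-concatMap⁺; ∈-filter⁺; ∈-filter⁻; ∈-upTo⁺)
open import Data.List.Relation.Unary.All as All using (All; []; _∷_)
open import Data.List.Relation.Unary.AllPairs using ([]; _∷_)
open import Data.List.Relation.Unary.Any using (here; there)
open import Data.List.Relation.Unary.Unique.Propositional using (Unique)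
open import Data.List.Relation.Unary.Unique.Propositional.Properties using (filter⁺)
open import Data.Nat hiding (_%_; _/_)
open import Data.Nat.DivMod using (_%_; _/_; m%n<n; m≡m%n+[m/n]*n; [m+kn]%n≡m%n)
open import Data.Nat.Properties
open import Data.Nat.Tactic.RingSolver using (solve-∀)
open import Data.Product using (∃; _×_; _,_; proj₁; proj₂)
open import Data.Sum using (_⊎_; inj₁; inj₂)
open import Function using (_∘_; Equivalence)
open import Relation.Binary.PropositionalEquality
open import Relation.Nullary using (¬_; contradiction)

-- The quadratic identity comes from the flag identity: multiplied by n(p) and summed over the
-- points of a plane, it expresses the squares of n in that plane through N, and these sums are then
-- added over the planes on a line. Dividing by 5 makes the endgame small: a line outside L carries
-- five weights m with sum x - c and five weights m′ with sum x - c′, so positive weights are nearly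
-- all 1 and a sum of squares decides the rest. The violating line joins p to a point of a second
-- plane through a line of π, chosen so that its weight and the weight at the intersection with π
-- are known; the two remaining weights would have sum 3 and square sum 7. The counts start from
-- axioms symmetric in points and planes, so each result for points also holds for planes. The lists
-- of points and lines stay variables throughout the argument, so the type checker evaluates the
-- enumeration only where the axioms are verified.

private variable
  A B : Set

-- Finite sums

𝟙 : Bool → ℕ
𝟙 b = if b then 1 else 0

∑ : List A → (A → ℕ) → ℕ
∑ []       f = 0
∑ (x ∷ xs) f = f x + ∑ xs f

∑-cong∈ : ∀ (xs : List A) {f g : A → ℕ} → (∀ {x} → x ∈ xs → f x ≡ g x) → ∑ xs f ≡ ∑ xs g
∑-cong∈ []       h = refl
∑-cong∈ (x ∷ xs) h = cong₂ _+_ (h (here refl)) (∑-cong∈ xs (h ∘ there))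

∑-cong : ∀ (xs : List A) {f g : A → ℕ} → (∀ x → f x ≡ g x) → ∑ xs f ≡ ∑ xs g
∑-cong xs h = ∑-cong∈ xs (λ {x} _ → h x)

∑-+ : ∀ (xs : List A) (f g : A → ℕ) → ∑ xs (λ x → f x + g x) ≡ ∑ xs f + ∑ xs g
∑-+ []       f g = refl
∑-+ (x ∷ xs) f g rewrite ∑-+ xs f g = interchange (f x) (g x) (∑ xs f) (∑ xs g)
  where
  interchange : ∀ a b c d → (a + b) + (c + d) ≡ (a + c) + (b + d)
  interchange = solve-∀

∑-*ˡ : ∀ (xs : List A) c (f : A → ℕ) → ∑ xs (λ x → c * f x) ≡ c * ∑ xs f
∑-*ˡ []       c f = sym (*-zeroʳ c)
∑-*ˡ (x ∷ xs) c f rewrite ∑-*ˡ xs c f = sym (*-distribˡ-+ c (f x) (∑ xs f))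

∑-*ʳ : ∀ (xs : List A) c (f : A → ℕ) → ∑ xs (λ x → f x * c) ≡ ∑ xs f * c
∑-*ʳ xs c f = begin
  ∑ xs (λ x → f x * c) ≡⟨ ∑-cong xs (λ x → *-comm (f x) c) ⟩
  ∑ xs (λ x → c * f x) ≡⟨ ∑-*ˡ xs c f ⟩
  c * ∑ xs f           ≡⟨ *-comm c _ ⟩
  ∑ xs f * c           ∎
  where open ≡-Reasoning

∑-zero : ∀ (xs : List A) → ∑ xs (λ _ → 0) ≡ 0
∑-zero []       = refl
∑-zero (x ∷ xs) = ∑-zero xs

∑-swap : ∀ (xs : List A) (ys : List B) (f : A → B → ℕ) →
  ∑ xs (λ x → ∑ ys (f x)) ≡ ∑ ys (λ y → ∑ xs (λ x → f x y))
∑-swap []       ys f = sym (∑-zero ys)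
∑-swap (x ∷ xs) ys f rewrite ∑-swap xs ys f = sym (∑-+ ys (f x) (λ y → ∑ xs (λ x → f x y)))

-- The common form of the double counts below: `b` is an incidence, and `a` and `c` weigh its two
-- sides.
∑-exchange : ∀ (xs : List A) (ys : List B) (a : A → ℕ) (b : A → B → ℕ) (c : B → ℕ) →
  ∑ xs (λ x → a x * ∑ ys (λ y → b x y * c y)) ≡ ∑ ys (λ y → ∑ xs (λ x → a x * b x y) * c y)
∑-exchange xs ys a b c = begin
  ∑ xs (λ x → a x * ∑ ys (λ y → b x y * c y))
    ≡⟨ ∑-cong xs (λ x → sym (∑-*ˡ ys (a x) _)) ⟩
  ∑ xs (λ x → ∑ ys (λ y → a x * (b x y * c y)))
    ≡⟨ ∑-swap xs ys _ ⟩
  ∑ ys (λ y → ∑ xs (λ x → a x * (b x y * c y)))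
    ≡⟨ ∑-cong ys (λ y → trans (∑-cong xs (λ x → sym (*-assoc (a x) _ _))) (∑-*ʳ xs (c y) _)) ⟩
  ∑ ys (λ y → ∑ xs (λ x → a x * b x y) * c y) ∎
  where open ≡-Reasoning

∑-mono∈ : ∀ (xs : List A) {f g : A → ℕ} → (∀ {x} → x ∈ xs → f x ≤ g x) → ∑ xs f ≤ ∑ xs g
∑-mono∈ []       h = z≤n
∑-mono∈ (x ∷ xs) h = +-mono-≤ (h (here refl)) (∑-mono∈ xs (h ∘ there))

∑-const : ∀ (xs : List A) c → ∑ xs (λ _ → c) ≡ length xs * c
∑-const []       c = refl
∑-const (x ∷ xs) c = cong (c +_) (∑-const xs c)

≤∑ : ∀ {xs : List A} {x} (f : A → ℕ) → x ∈ xs → f x ≤ ∑ xs f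
≤∑ {xs = _ ∷ xs} f (here refl)  = m≤m+n _ _
≤∑ {xs = y ∷ _}  f (there x∈xs) = ≤-trans (≤∑ f x∈xs) (m≤n+m _ (f y))

∑-positive : ∀ (xs : List A) (f : A → ℕ) → 1 ≤ ∑ xs f → ∃ λ x → x ∈ xs × 1 ≤ f x
∑-positive (x ∷ xs) f h with f x in eq
... | suc k = x , here refl , subst (1 ≤_) (sym eq) (s≤s z≤n)
... | zero  = let y , y∈ , fy = ∑-positive xs f h in y , there y∈ , fy

∑-filterᵇ : ∀ (xs : List A) (b : A → Bool) (f : A → ℕ) → ∑ (filterᵇ b xs) f ≡ ∑ xs (λ x → 𝟙 (b x) * f x)
∑-filterᵇ []       b f = refl
∑-filterᵇ (x ∷ xs) b f with b x
... | true  = cong₂ _+_ (sym (*-identityˡ (f x))) (∑-filterᵇ xs b f)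
... | false = ∑-filterᵇ xs b f

length-filterᵇ : ∀ (xs : List A) (b : A → Bool) → length (filterᵇ b xs) ≡ ∑ xs (𝟙 ∘ b)
length-filterᵇ []       b = refl
length-filterᵇ (x ∷ xs) b with b x
... | true  = cong suc (length-filterᵇ xs b)
... | false = length-filterᵇ xs b

∈-filterᵇ⁺ : ∀ {xs : List A} {x} (b : A → Bool) → x ∈ xs → b x ≡ true → x ∈ filterᵇ b xs
∈-filterᵇ⁺ b x∈xs bx = ∈-filter⁺ (T? ∘ b) x∈xs (Equivalence.from T-≡ bx)

∈-filterᵇ⁻ : ∀ {xs : List A} {x} (b : A → Bool) → x ∈ filterᵇ b xs → b x ≡ true
∈-filterᵇ⁻ {xs = xs} b x∈ = Equivalence.to T-≡ (proj₂ (∈-filter⁻ (T? ∘ b) {xs = xs} x∈))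

-- Singles out one point or plane on a line, so that the weights of the other four can be estimated
-- separately.
record Removal {A : Set} (x : A) (xs : List A) : Set where
  field
    rest    : List A
    sum     : ∀ f → ∑ xs f ≡ f x + ∑ rest f
    size    : length xs ≡ suc (length rest)
    stays   : ∀ {y} → y ∈ xs → x ≢ y → y ∈ rest
    ⊆       : ∀ {y} → y ∈ rest → y ∈ xs
    unique  : Unique rest
    removed : ∀ {y} → y ∈ rest → x ≢ y

remove : ∀ {x : A} {xs} → Unique xs → x ∈ xs → Removal x xs
remove {xs = x ∷ xs} (x∉ ∷ u) (here refl) = record
  { rest = xs
  ; sum = λ f → refl
  ; size = refl
  ; stays = λ { (here refl) x≢y → contradiction refl x≢y ; (there y∈) _ → y∈ }
  ; ⊆ = there
  ; unique = u
  ; removed = All.lookup x∉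
  }
remove {x = x} {xs = y ∷ xs} (y∉ ∷ u) (there x∈) = record
  { rest = y ∷ rest
  ; sum = λ f → trans (cong (f y +_) (sum f)) (swap (f y) (f x) (∑ rest f))
  ; size = cong suc size
  ; stays = λ { (here refl) _ → here refl ; (there z∈) x≢z → there (stays z∈ x≢z) }
  ; ⊆ = λ { (here refl) → here refl ; (there z∈) → there (⊆ z∈) }
  ; unique = All.tabulate (λ z∈ → All.lookup y∉ (⊆ z∈)) ∷ unique
  ; removed = λ { (here refl) → λ { refl → All.lookup y∉ x∈ refl } ; (there z∈) → removed z∈ }
  }
  where
  open Removal (remove u x∈)
  swap : ∀ a b c → a + (b + c) ≡ b + (a + c)
  swap = solve-∀

-- All other entries take at least 1 each, so a single entry can absorb at most the surplus `e`.
≤-excess : ∀ {xs : List A} {x} (f : A → ℕ) e → Unique xs → (∀ {y} → y ∈ xs → 1 ≤ f y) →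
  ∑ xs f ≤ length xs + e → x ∈ xs → f x ≤ 1 + e
≤-excess {xs = xs} {x} f e u pos h x∈ = +-cancelʳ-≤ (length rest) (f x) (1 + e) (begin
  f x + length rest           ≡⟨ cong (f x +_) (sym (trans (∑-const rest 1) (*-identityʳ _))) ⟩
  f x + ∑ rest (λ _ → 1)      ≤⟨ +-monoʳ-≤ (f x) (∑-mono∈ rest (pos ∘ ⊆)) ⟩
  f x + ∑ rest f              ≡⟨ sum f ⟨
  ∑ xs f                      ≤⟨ h ⟩
  length xs + e               ≡⟨ cong (_+ e) size ⟩
  suc (length rest) + e       ≡⟨ cong suc (+-comm (length rest) e) ⟩
  1 + e + length rest         ∎)
  where
  open Removal (remove u x∈)
  open ≤-Reasoning

-- Boolean checks over finite lists

allᵇ : List A → (A → Bool) → Bool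
allᵇ []       f = true
allᵇ (x ∷ xs) f = f x ∧ allᵇ xs f

∧-split : ∀ {a b} → a ∧ b ≡ true → a ≡ true × b ≡ true
∧-split {true} h = refl , h

allᵇ-sound : ∀ {xs : List A} {f x} → allᵇ xs f ≡ true → x ∈ xs → f x ≡ true
allᵇ-sound h (here refl) = proj₁ (∧-split h)
allᵇ-sound {f = f} h (there x∈) = allᵇ-sound {f = f} (proj₂ (∧-split h)) x∈

any-intro : ∀ {xs : List A} {x} f → x ∈ xs → f x ≡ true → any f xs ≡ true
any-intro f (here refl) h rewrite h = refl
any-intro {xs = y ∷ _} f (there x∈) h with f y
... | true  = refl
... | false = any-intro f x∈ h

any-elim : ∀ (xs : List A) {f} → any f xs ≡ true → ∃ λ x → x ∈ xs × f x ≡ true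
any-elim (x ∷ xs) {f} h with f x in eq
... | true  = x , here refl , eq
... | false = let y , y∈ , fy = any-elim xs h in y , there y∈ , fy

≡ᵇ-sound : ∀ {m n} → (m ≡ᵇ n) ≡ true → m ≡ n
≡ᵇ-sound {m} {n} h = ≡ᵇ⇒≡ m n (Equivalence.from T-≡ h)

-- The field and the vector space

∈GF4 : ∀ x → x ∈ allGF4
∈GF4 o  = here refl
∈GF4 i  = there (here refl)
∈GF4 w  = there (there (here refl))
∈GF4 w2 = there (there (there (here refl)))

==F-refl : ∀ x → (x ==F x) ≡ true
==F-refl o  = refl
==F-refl i  = refl
==F-refl w  = refl
==F-refl w2 = refl

==F-sound : ∀ x y → (x ==F y) ≡ true → x ≡ y
==F-sound o  o  _ = refl
==F-sound i  i  _ = refl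
==F-sound w  w  _ = refl
==F-sound w2 w2 _ = refl

==V-refl : ∀ v → (v ==V v) ≡ true
==V-refl (v4 a b c d) rewrite ==F-refl a | ==F-refl b | ==F-refl c | ==F-refl d = refl

==V-sound : ∀ u v → (u ==V v) ≡ true → u ≡ v
==V-sound (v4 a b c d) (v4 a' b' c' d') h
  with h₁ , h ← ∧-split {a ==F a'} h
  with h₂ , h ← ∧-split {b ==F b'} h
  with h₃ , h₄ ← ∧-split {c ==F c'} h
  with refl ← ==F-sound a a' h₁ | refl ← ==F-sound b b' h₂
     | refl ← ==F-sound c c' h₃ | refl ← ==F-sound d d' h₄ = refl

⊗-identityʳ : ∀ x → x ⊗ i ≡ x
⊗-identityʳ o  = refl
⊗-identityʳ i  = refl
⊗-identityʳ w  = refl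
⊗-identityʳ w2 = refl

⊗-zeroʳ : ∀ x → x ⊗ o ≡ o
⊗-zeroʳ o  = refl
⊗-zeroʳ i  = refl
⊗-zeroʳ w  = refl
⊗-zeroʳ w2 = refl

⊕-identityʳ : ∀ x → x ⊕ o ≡ x
⊕-identityʳ o  = refl
⊕-identityʳ i  = refl
⊕-identityʳ w  = refl
⊕-identityʳ w2 = refl

-- Checked on all 1024 quintuples of field elements; it combines associativity and distributivity in
-- the shape needed to scale a vector of a line.
⊗-linear : ∀ k s t x y → k ⊗ ((s ⊗ x) ⊕ (t ⊗ y)) ≡ ((k ⊗ s) ⊗ x) ⊕ ((k ⊗ t) ⊗ y)
⊗-linear k s t x y = ==F-sound _ _
  (allᵇ-sound {f = λ y → identity k s t x y}
  (allᵇ-sound {f = λ x → allᵇ allGF4 λ y → identity k s t x y}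
  (allᵇ-sound {f = λ t → allᵇ allGF4 λ x → allᵇ allGF4 λ y → identity k s t x y}
  (allᵇ-sound {f = λ s → allᵇ allGF4 λ t → allᵇ allGF4 λ x → allᵇ allGF4 λ y → identity k s t x y}
  (allᵇ-sound {xs = allGF4}
    {f = λ k → allᵇ allGF4 λ s → allᵇ allGF4 λ t → allᵇ allGF4 λ x → allᵇ allGF4 λ y → identity k s t x y}
    refl (∈GF4 k)) (∈GF4 s)) (∈GF4 t)) (∈GF4 x)) (∈GF4 y))
  where
  identity : GF4 → GF4 → GF4 → GF4 → GF4 → Bool
  identity k s t x y = (k ⊗ ((s ⊗ x) ⊕ (t ⊗ y))) ==F (((k ⊗ s) ⊗ x) ⊕ ((k ⊗ t) ⊗ y))

·V-comb : ∀ k l a b → k ·V comb l a b ≡ comb l (k ⊗ a) (k ⊗ b)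
·V-comb k l a b with row₁ l | row₂ l
... | v4 x₁ x₂ x₃ x₄ | v4 y₁ y₂ y₃ y₄
  rewrite ⊗-linear k a b x₁ y₁ | ⊗-linear k a b x₂ y₂ | ⊗-linear k a b x₃ y₃ | ⊗-linear k a b x₄ y₄ = refl

-- Points; the same vectors serve as coordinates of planes.

data Pt : Set where
  p₀ : GF4 → GF4 → GF4 → Pt
  p₁ : GF4 → GF4 → Pt
  p₂ : GF4 → Pt
  p₃ : Pt

vec : Pt → V4
vec (p₀ a b c) = v4 i a b c
vec (p₁ a b)   = v4 o i a b
vec (p₂ a)     = v4 o o i a
vec p₃         = v4 o o o i

-- The factor is the inverse of the first nonzero coordinate; `w` and `w2` are inverse to each
-- other.
scale-to-point : ∀ v → v ≢ v4 o o o o → ∃ λ k → ∃ λ p → k ·V v ≡ vec p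
scale-to-point (v4 i  b c d) _ = i  , p₀ (i  ⊗ b) (i  ⊗ c) (i  ⊗ d) , refl
scale-to-point (v4 w  b c d) _ = w2 , p₀ (w2 ⊗ b) (w2 ⊗ c) (w2 ⊗ d) , refl
scale-to-point (v4 w2 b c d) _ = w  , p₀ (w  ⊗ b) (w  ⊗ c) (w  ⊗ d) , refl
scale-to-point (v4 o i  c d) _ = i  , p₁ (i  ⊗ c) (i  ⊗ d) , refl
scale-to-point (v4 o w  c d) _ = w2 , p₁ (w2 ⊗ c) (w2 ⊗ d) , refl
scale-to-point (v4 o w2 c d) _ = w  , p₁ (w  ⊗ c) (w  ⊗ d) , refl
scale-to-point (v4 o o i  d) _ = i  , p₂ (i  ⊗ d) , refl
scale-to-point (v4 o o w  d) _ = w2 , p₂ (w2 ⊗ d) , refl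
scale-to-point (v4 o o w2 d) _ = w  , p₂ (w  ⊗ d) , refl
scale-to-point (v4 o o o i ) _ = i  , p₃ , refl
scale-to-point (v4 o o o w ) _ = w2 , p₃ , refl
scale-to-point (v4 o o o w2) _ = w  , p₃ , refl
scale-to-point (v4 o o o o ) v≢0 = contradiction refl v≢0

vec≢0 : ∀ p → vec p ≢ v4 o o o o
vec≢0 (p₀ _ _ _) ()
vec≢0 (p₁ _ _)   ()
vec≢0 (p₂ _)     ()
vec≢0 p₃         ()

_==P_ : Pt → Pt → Bool
p ==P q = vec p ==V vec q

vec-injective : ∀ p q → vec p ≡ vec q → p ≡ q
vec-injective (p₀ _ _ _) (p₀ _ _ _) refl = refl
vec-injective (p₁ _ _)   (p₁ _ _)   refl = refl
vec-injective (p₂ _)     (p₂ _)     refl = refl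
vec-injective p₃         p₃         refl = refl

==P-sound : ∀ p q → (p ==P q) ≡ true → p ≡ q
==P-sound p q h = vec-injective p q (==V-sound _ _ h)

==P-refl : ∀ p → (p ==P p) ≡ true
==P-refl p = ==V-refl (vec p)

==P-false : ∀ p q → p ≢ q → (p ==P q) ≡ false
==P-false p q p≢q with p ==P q in eq
... | true  = contradiction (==P-sound p q eq) p≢q
... | false = refl

allPts : List Pt
allPts =
     concatMap (λ a → concatMap (λ b → map (p₀ a b) allGF4) allGF4) allGF4
  ++ concatMap (λ a → map (p₁ a) allGF4) allGF4
  ++ map p₂ allGF4
  ++ p₃ ∷ []

gather : (GF4 → List A) → List A
gather f = concatMap f allGF4

values : (GF4 → A) → List A
values f = map f allGF4

∈gather : ∀ (f : GF4 → List A) a {y} → y ∈ f a → y ∈ gather f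
∈gather f a y∈ = ∈-concatMap⁺ f (lose (∈GF4 a) y∈)

∈values : ∀ (f : GF4 → A) a → f a ∈ values f
∈values f a = ∈-map⁺ f (∈GF4 a)

∈allPts : ∀ p → p ∈ allPts
∈allPts (p₀ a b c) = ∈-++⁺ˡ (∈gather (λ a → gather λ b → values (p₀ a b)) a (∈gather (λ b → values (p₀ a b)) b (∈values (p₀ a b) c)))
∈allPts (p₁ a b)   = ∈-++⁺ʳ (gather λ a → gather λ b → values (p₀ a b))
  (∈-++⁺ˡ (∈gather (λ a → values (p₁ a)) a (∈values (p₁ a) b)))
∈allPts (p₂ a)     = ∈-++⁺ʳ (gather λ a → gather λ b → values (p₀ a b))
  (∈-++⁺ʳ (gather λ a → values (p₁ a)) (∈-++⁺ˡ (∈values p₂ a)))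
∈allPts p₃         = ∈-++⁺ʳ (gather λ a → gather λ b → values (p₀ a b))
  (∈-++⁺ʳ (gather λ a → values (p₁ a)) (∈-++⁺ʳ (values p₂) (here refl)))

lines₀₁ lines₀₂ lines₀₃ lines₁₂ lines₁₃ : List Line
lines₀₁ = gather λ a → gather λ b → gather λ c → values (l01 a b c)
lines₀₂ = gather λ a → gather λ b → values (l02 a b)
lines₀₃ = gather λ a → values (l03 a)
lines₁₂ = gather λ a → values (l12 a)
lines₁₃ = values l13

∈allLines : ∀ l → l ∈ allLines
∈allLines (l01 a b c d) = ∈-++⁺ˡ
  (∈gather (λ a → gather λ b → gather λ c → values (l01 a b c)) a
  (∈gather (λ b → gather λ c → values (l01 a b c)) b
  (∈gather (λ c → values (l01 a b c)) c (∈values (l01 a b c) d))))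
∈allLines (l02 a b c) = ∈-++⁺ʳ lines₀₁ (∈-++⁺ˡ
  (∈gather (λ a → gather λ b → values (l02 a b)) a (∈gather (λ b → values (l02 a b)) b (∈values (l02 a b) c))))
∈allLines (l03 a b) = ∈-++⁺ʳ lines₀₁ (∈-++⁺ʳ lines₀₂ (∈-++⁺ˡ
  (∈gather (λ a → values (l03 a)) a (∈values (l03 a) b))))
∈allLines (l12 a b) = ∈-++⁺ʳ lines₀₁ (∈-++⁺ʳ lines₀₂ (∈-++⁺ʳ lines₀₃ (∈-++⁺ˡ
  (∈gather (λ a → values (l12 a)) a (∈values (l12 a) b)))))
∈allLines (l13 a) = ∈-++⁺ʳ lines₀₁ (∈-++⁺ʳ lines₀₂ (∈-++⁺ʳ lines₀₃ (∈-++⁺ʳ lines₁₂ (∈-++⁺ˡ (∈values l13 a)))))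
∈allLines l23     = ∈-++⁺ʳ lines₀₁ (∈-++⁺ʳ lines₀₂ (∈-++⁺ʳ lines₀₃ (∈-++⁺ʳ lines₁₂ (∈-++⁺ʳ lines₁₃ (here refl)))))

-- Coordinates of a vector in the pivot columns of a line.

piv₁ piv₂ : Line → V4 → GF4
piv₁ (l01 _ _ _ _) (v4 a b c d) = a
piv₁ (l02 _ _ _)   (v4 a b c d) = a
piv₁ (l03 _ _)     (v4 a b c d) = a
piv₁ (l12 _ _)     (v4 a b c d) = b
piv₁ (l13 _)       (v4 a b c d) = b
piv₁ l23           (v4 a b c d) = c
piv₂ (l01 _ _ _ _) (v4 a b c d) = b
piv₂ (l02 _ _ _)   (v4 a b c d) = c
piv₂ (l03 _ _)     (v4 a b c d) = d
piv₂ (l12 _ _)     (v4 a b c d) = c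
piv₂ (l13 _)       (v4 a b c d) = d
piv₂ l23           (v4 a b c d) = d

pivot-one : ∀ x y → (x ⊗ i) ⊕ (y ⊗ o) ≡ x
pivot-one x y rewrite ⊗-identityʳ x | ⊗-zeroʳ y = ⊕-identityʳ x

pivot-two : ∀ x y → (x ⊗ o) ⊕ (y ⊗ i) ≡ y
pivot-two x y rewrite ⊗-identityʳ y | ⊗-zeroʳ x = refl

piv₁-comb : ∀ l a b → piv₁ l (comb l a b) ≡ a
piv₁-comb (l01 _ _ _ _) = pivot-one
piv₁-comb (l02 _ _ _)   = pivot-one
piv₁-comb (l03 _ _)     = pivot-one
piv₁-comb (l12 _ _)     = pivot-one
piv₁-comb (l13 _)       = pivot-one
piv₁-comb l23           = pivot-one

piv₂-comb : ∀ l a b → piv₂ l (comb l a b) ≡ b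
piv₂-comb (l01 _ _ _ _) = pivot-two
piv₂-comb (l02 _ _ _)   = pivot-two
piv₂-comb (l03 _ _)     = pivot-two
piv₂-comb (l12 _ _)     = pivot-two
piv₂-comb (l13 _)       = pivot-two
piv₂-comb l23           = pivot-two

piv₁-zero : ∀ l → piv₁ l (v4 o o o o) ≡ o
piv₁-zero (l01 _ _ _ _) = refl
piv₁-zero (l02 _ _ _)   = refl
piv₁-zero (l03 _ _)     = refl
piv₁-zero (l12 _ _)     = refl
piv₁-zero (l13 _)       = refl
piv₁-zero l23           = refl

piv₂-zero : ∀ l → piv₂ l (v4 o o o o) ≡ o
piv₂-zero (l01 _ _ _ _) = refl
piv₂-zero (l02 _ _ _)   = refl
piv₂-zero (l03 _ _)     = refl
piv₂-zero (l12 _ _)     = refl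
piv₂-zero (l13 _)       = refl
piv₂-zero l23           = refl

comb-zero : ∀ l → comb l o o ≡ v4 o o o o
comb-zero l with row₁ l | row₂ l
... | v4 _ _ _ _ | v4 _ _ _ _ = refl

inSpan : Line → V4 → Bool
inSpan l v = v ==V comb l (piv₁ l v) (piv₂ l v)

inSpan-comb : ∀ l a b → inSpan l (comb l a b) ≡ true
inSpan-comb l a b rewrite piv₁-comb l a b | piv₂-comb l a b = ==V-refl (comb l a b)

-- Incidence, and its relation to `meets`

perp : V4 → V4 → Bool
perp (v4 a b c d) (v4 a' b' c' d') = (((a ⊗ a') ⊕ (b ⊗ b')) ⊕ ((c ⊗ c') ⊕ (d ⊗ d'))) ==F o

onLine onPlane : Pt → Line → Bool
onLine p l  = inSpan l (vec p)
onPlane π l = perp (vec π) (row₁ l) ∧ perp (vec π) (row₂ l)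

incident : Pt → Pt → Bool
incident p π = perp (vec p) (vec π)

isZero-false : ∀ a b → (a ≡ o → b ≡ o → ⊥) → not (isZero a b) ≡ true
isZero-false a b h with isZero a b in eq
... | false = refl
... | true  = let a≡o , b≡o = ∧-split {a ==F o} eq in ⊥-elim (h (==F-sound a o a≡o) (==F-sound b o b≡o))

isZero-elim : ∀ a b → not (isZero a b) ≡ true → a ≡ o → b ≡ o → ⊥
isZero-elim o o () refl refl

-- The witnesses of the four searches in `meets` are the pivot entries of `vec p` with respect to
-- the two lines.
meets-intro : ∀ {p} l m → onLine p l ≡ true → onLine p m ≡ true → meets l m ≡ true
meets-intro {p} l m pl pm =
  any-intro (λ a → any (λ b → not (isZero a b) ∧ common a b) allGF4) (∈GF4 a)
    (any-intro (λ b → not (isZero a b) ∧ common a b) (∈GF4 b) (∧-intro (isZero-false a b nonzero)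
      (any-intro (λ c → any (λ d → comb l a b ==V comb m c d) allGF4) (∈GF4 c)
        (any-intro (λ d → comb l a b ==V comb m c d) (∈GF4 d)
          (subst₂ (λ u v → (u ==V v) ≡ true) p≡l p≡m (==V-refl (vec p)))))))
  where
  common : GF4 → GF4 → Bool
  common a b = any (λ c → any (λ d → comb l a b ==V comb m c d) allGF4) allGF4
  a b c d : GF4
  a = piv₁ l (vec p)
  b = piv₂ l (vec p)
  c = piv₁ m (vec p)
  d = piv₂ m (vec p)
  p≡l : vec p ≡ comb l a b
  p≡l = ==V-sound _ _ pl
  p≡m : vec p ≡ comb m c d
  p≡m = ==V-sound _ _ pm
  ∧-intro : ∀ {x y} → x ≡ true → y ≡ true → x ∧ y ≡ true
  ∧-intro refl refl = refl
  nonzero : a ≡ o → b ≡ o → ⊥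
  nonzero a≡o b≡o = vec≢0 p (trans p≡l (trans (cong₂ (comb l) a≡o b≡o) (comb-zero l)))

-- The common vector found by `meets` need not be normalised; the multiple of it that represents a
-- point still lies in both spans.
meets-elim : ∀ l m → meets l m ≡ true → ∃ λ p → onLine p l ≡ true × onLine p m ≡ true
meets-elim l m h
  with a , _ , h ← any-elim allGF4 h
  with b , _ , h ← any-elim allGF4 h
  with ab≢0 , h ← ∧-split {not (isZero a b)} h
  with c , _ , h ← any-elim allGF4 h
  with d , _ , h ← any-elim allGF4 h
  = p , on l a b v≡p , on m c d (trans (cong (k ·V_) (sym v≡)) v≡p)
  where
  v≡ : comb l a b ≡ comb m c d
  v≡ = ==V-sound _ _ h
  v≢0 : comb l a b ≢ v4 o o o o
  v≢0 e = isZero-elim a b ab≢0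
    (trans (sym (piv₁-comb l a b)) (trans (cong (piv₁ l) e) (piv₁-zero l)))
    (trans (sym (piv₂-comb l a b)) (trans (cong (piv₂ l) e) (piv₂-zero l)))
  scaled = scale-to-point (comb l a b) v≢0
  k = proj₁ scaled
  p = proj₁ (proj₂ scaled)
  v≡p : k ·V comb l a b ≡ vec p
  v≡p = proj₂ (proj₂ scaled)
  on : ∀ l a b → k ·V comb l a b ≡ vec p → onLine p l ≡ true
  on l a b e = subst (λ v → inSpan l v ≡ true) (trans (sym (·V-comb k l a b)) e)
    (inSpan-comb l (k ⊗ a) (k ⊗ b))

∑-δ : ∀ {xs : List A} {x} (b : A → Bool) (f : A → ℕ) → Unique xs → x ∈ xs →
  b x ≡ true → (∀ y → b y ≡ true → x ≡ y) → ∑ xs (λ y → 𝟙 (b y) * f y) ≡ f x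
∑-δ {xs = xs} {x} b f u x∈ bx only = begin
  ∑ xs (λ y → 𝟙 (b y) * f y)                  ≡⟨ sum _ ⟩
  𝟙 (b x) * f x + ∑ rest (λ y → 𝟙 (b y) * f y) ≡⟨ cong₂ _+_ (cong (λ c → 𝟙 c * f x) bx) (trans (∑-cong∈ rest vanish) (∑-zero rest)) ⟩
  1 * f x + 0                                  ≡⟨ trans (+-identityʳ _) (*-identityˡ (f x)) ⟩
  f x                                          ∎
  where
  open Removal (remove u x∈)
  open ≡-Reasoning
  vanish : ∀ {y} → y ∈ rest → 𝟙 (b y) * f y ≡ 0
  vanish {y} y∈ with b y in eq
  ... | true  = contradiction (only y eq) (removed y∈)
  ... | false = refl

distinctᵇ : (A → A → Bool) → List A → Bool
distinctᵇ eq []       = true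
distinctᵇ eq (x ∷ xs) = allᵇ xs (λ y → not (eq x y)) ∧ distinctᵇ eq xs

distinctᵇ-sound : ∀ (eq : A → A → Bool) → (∀ x → eq x x ≡ true) → ∀ xs → distinctᵇ eq xs ≡ true → Unique xs
distinctᵇ-sound eq eq-refl []       h = []
distinctᵇ-sound eq eq-refl (x ∷ xs) h =
  All.tabulate (λ { y∈ refl → different (allᵇ-sound {f = λ y → not (eq x y)} (proj₁ (∧-split h)) y∈) })
  ∷ distinctᵇ-sound eq eq-refl xs (proj₂ (∧-split {allᵇ xs (λ y → not (eq x y))} h))
  where
  different : not (eq x x) ≡ true → ⊥
  different e rewrite eq-refl x = contradiction e (λ ())

-- Left inverse of the pair of rows, by which equal rows give equal lines. The clauses locate the
-- pivots; on pairs that are not echelon bases the value is arbitrary.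
decode : V4 → V4 → Line
decode (v4 _ _ a b) (v4 _ i c d) = l01 a b c d
decode (v4 i a _ b) (v4 _ _ i c) = l02 a b c
decode (v4 _ _ _ a) (v4 _ _ i b) = l12 a b
decode (v4 i a b _) _            = l03 a b
decode (v4 _ i a _) _            = l13 a
decode _            _            = l23

decode-rows : ∀ l → decode (row₁ l) (row₂ l) ≡ l
decode-rows (l01 _ _ _ _) = refl
decode-rows (l02 _ _ _)   = refl
decode-rows (l03 _ _)     = refl
decode-rows (l12 _ _)     = refl
decode-rows (l13 _)       = refl
decode-rows l23           = refl

==L-sound : ∀ l m → (l ==L m) ≡ true → l ≡ m
==L-sound l m h with e₁ , e₂ ← ∧-split {row₁ l ==V row₁ m} h =
  trans (sym (decode-rows l))
    (trans (cong₂ decode (==V-sound _ _ e₁) (==V-sound _ _ e₂)) (decode-rows m))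

==L-refl : ∀ l → (l ==L l) ≡ true
==L-refl l rewrite ==V-refl (row₁ l) = ==V-refl (row₂ l)

-- Incidence axioms.  I, J and K are the incidences point-line, plane-line and
-- point-plane; the axioms are invariant under exchanging points and planes.

record Space (points : List Pt) (lines : List Line)
             (I J : Pt → Line → Bool) (K : Pt → Pt → Bool) : Set where
  field
    all-points    : ∀ p → p ∈ points
    points-unique : Unique points
    all-lines     : ∀ l → l ∈ lines
    lines-unique  : Unique lines
    lines-number  : length lines ≡ 357
    -- The counts are single equations with indicators that include the degenerate cases, so that
    -- they can be rewritten inside a sum.
    section   : ∀ l π → ∑ points (λ p → 𝟙 (I p l) * 𝟙 (K p π)) ≡ 1 + 4 * 𝟙 (J π l)
    section′  : ∀ l p → ∑ points (λ π → 𝟙 (J π l) * 𝟙 (K p π)) ≡ 1 + 4 * 𝟙 (I p l)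
    flag      : ∀ {l p π} → I p l ≡ true → J π l ≡ true → K p π ≡ true
    join      : ∀ p q → ∑ lines (λ l → 𝟙 (I p l) * 𝟙 (I q l)) ≡ 1 + 20 * 𝟙 (p ==P q)
    join′     : ∀ π ρ → ∑ lines (λ l → 𝟙 (J π l) * 𝟙 (J ρ l)) ≡ 1 + 20 * 𝟙 (π ==P ρ)
    size      : ∀ l → ∑ points (λ p → 𝟙 (I p l)) ≡ 5
    size′     : ∀ l → ∑ points (λ π → 𝟙 (J π l)) ≡ 5
    pencil    : ∀ {p π} → K p π ≡ true → ∑ lines (λ l → 𝟙 (I p l) * 𝟙 (J π l)) ≡ 5
    separate  : ∀ π ρ → π ≢ ρ → ∃ λ q → K q ρ ≡ true × K q π ≡ false
    separate′ : ∀ p q → p ≢ q → ∃ λ π → K q π ≡ true × K p π ≡ false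
    common    : ∀ l m → ∑ points (λ p → 𝟙 (I p l) * 𝟙 (I p m)) ≡ 𝟙 (not (m ==L l) ∧ meets m l) + 5 * 𝟙 (m ==L l)
    common′   : ∀ l m → ∑ points (λ π → 𝟙 (J π l) * 𝟙 (J π m)) ≡ 𝟙 (not (m ==L l) ∧ meets m l) + 5 * 𝟙 (m ==L l)

dual : ∀ {points lines I J K} → Space points lines I J K → Space points lines J I (λ π p → K p π)
dual {lines = lines} {I} {J} S = record
  { all-points = all-points ; points-unique = points-unique
  ; all-lines = all-lines ; lines-unique = lines-unique ; lines-number = lines-number
  ; section = section′ ; section′ = section ; flag = λ a b → flag b a
  ; join = join′ ; join′ = join ; size = size′ ; size′ = size
  ; pencil = λ {π} {p} k → trans (∑-cong lines λ l → *-comm (𝟙 (J π l)) (𝟙 (I p l))) (pencil k)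
  ; separate = separate′ ; separate′ = separate ; common = common′ ; common′ = common }
  where open Space S

-- Verification of the incidence axioms by evaluation

module Checks (points : List Pt) (lines : List Line)
              (all-points : ∀ p → p ∈ points) (all-lines : ∀ l → l ∈ lines)
              (I J : Pt → Line → Bool) (K : Pt → Pt → Bool) where

  pointsOf : Line → List Pt
  pointsOf l = filterᵇ (λ p → I p l) points

  linesThrough : Pt → List Line
  linesThrough p = filterᵇ (I p) lines

  -- The filtered lists are passed to named functions so that they are evaluated only once.
  sectionᵇ flagᵇ commonᵇ : List Pt → Line → Bool
  sectionᵇ ps l = allᵇ points λ π → ∑ ps (λ p → 𝟙 (K p π)) ≡ᵇ 1 + 4 * 𝟙 (J π l)
  flagᵇ ps l    = allᵇ points λ π → if J π l then allᵇ ps (λ p → K p π) else true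
  commonᵇ ps l  = allᵇ lines λ m →
    if m ==L l then ∑ ps (λ p → 𝟙 (I p m)) ≡ᵇ 5 else ∑ ps (λ p → 𝟙 (I p m)) <ᵇ 2

  joinᵇ pencilᵇ : List Line → Pt → Bool
  joinᵇ ls p   = allᵇ points λ q → ∑ ls (λ l → 𝟙 (I q l)) ≡ᵇ 1 + 20 * 𝟙 (p ==P q)
  pencilᵇ ls p = allᵇ points λ π → if K p π then ∑ ls (λ l → 𝟙 (J π l)) ≡ᵇ 5 else true

  sizeᵇ : Line → Bool
  sizeᵇ l = length (pointsOf l) ≡ᵇ 5

  separateᵇ : Pt → Bool
  separateᵇ π = allᵇ points λ ρ → if π ==P ρ then true else any (λ q → K q ρ ∧ not (K q π)) points

  section-sound : allᵇ lines (λ l → sectionᵇ (pointsOf l) l) ≡ true →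
    ∀ l π → ∑ points (λ p → 𝟙 (I p l) * 𝟙 (K p π)) ≡ 1 + 4 * 𝟙 (J π l)
  section-sound h l π = trans (sym (∑-filterᵇ points (λ p → I p l) _))
    (≡ᵇ-sound (allᵇ-sound {f = λ π → ∑ (pointsOf l) (λ p → 𝟙 (K p π)) ≡ᵇ 1 + 4 * 𝟙 (J π l)}
      (allᵇ-sound {f = λ l → sectionᵇ (pointsOf l) l} h (all-lines l)) (all-points π)))

  flag-sound : allᵇ lines (λ l → flagᵇ (pointsOf l) l) ≡ true →
    ∀ {l p π} → I p l ≡ true → J π l ≡ true → K p π ≡ true
  flag-sound h {l} {p} {π} pl πl = allᵇ-sound {f = λ p → K p π}
    (subst (λ b → (if b then allᵇ (pointsOf l) (λ p → K p π) else true) ≡ true) πl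
      (allᵇ-sound {f = λ π → if J π l then allᵇ (pointsOf l) (λ p → K p π) else true}
        (allᵇ-sound {f = λ l → flagᵇ (pointsOf l) l} h (all-lines l)) (all-points π)))
    (∈-filterᵇ⁺ (λ p → I p l) (all-points p) pl)

  join-sound : allᵇ points (λ p → joinᵇ (linesThrough p) p) ≡ true →
    ∀ p q → ∑ lines (λ l → 𝟙 (I p l) * 𝟙 (I q l)) ≡ 1 + 20 * 𝟙 (p ==P q)
  join-sound h p q = trans (sym (∑-filterᵇ lines (I p) _))
    (≡ᵇ-sound (allᵇ-sound {f = λ q → ∑ (linesThrough p) (λ l → 𝟙 (I q l)) ≡ᵇ 1 + 20 * 𝟙 (p ==P q)}
      (allᵇ-sound {f = λ p → joinᵇ (linesThrough p) p} h (all-points p)) (all-points q)))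

  pencil-sound : allᵇ points (λ p → pencilᵇ (linesThrough p) p) ≡ true →
    ∀ {p π} → K p π ≡ true → ∑ lines (λ l → 𝟙 (I p l) * 𝟙 (J π l)) ≡ 5
  pencil-sound h {p} {π} pπ = trans (sym (∑-filterᵇ lines (I p) _))
    (≡ᵇ-sound (subst (λ b → (if b then ∑ (linesThrough p) (λ l → 𝟙 (J π l)) ≡ᵇ 5 else true) ≡ true) pπ
      (allᵇ-sound {f = λ π → if K p π then ∑ (linesThrough p) (λ l → 𝟙 (J π l)) ≡ᵇ 5 else true}
        (allᵇ-sound {f = λ p → pencilᵇ (linesThrough p) p} h (all-points p)) (all-points π))))

  size-sound : allᵇ lines sizeᵇ ≡ true → ∀ l → ∑ points (λ p → 𝟙 (I p l)) ≡ 5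
  size-sound h l = trans (sym (length-filterᵇ points (λ p → I p l)))
    (≡ᵇ-sound (allᵇ-sound {f = sizeᵇ} h (all-lines l)))

  separate-sound : allᵇ points separateᵇ ≡ true →
    ∀ π ρ → π ≢ ρ → ∃ λ q → K q ρ ≡ true × K q π ≡ false
  separate-sound h π ρ π≢ρ
    with q , _ , e ← any-elim points {λ q → K q ρ ∧ not (K q π)}
           (subst (λ b → (if b then true else any (λ q → K q ρ ∧ not (K q π)) points) ≡ true) (==P-false π ρ π≢ρ)
             (allᵇ-sound {f = λ ρ → if π ==P ρ then true else any (λ q → K q ρ ∧ not (K q π)) points}
               (allᵇ-sound {f = separateᵇ} h (all-points π)) (all-points ρ)))
    with e₁ , e₂ ← ∧-split {K q ρ} e = q , e₁ , not-true (K q π) e₂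
    where
    not-true : ∀ b → not b ≡ true → b ≡ false
    not-true false _ = refl

  -- The test avoids the search over coefficients inside `meets`: it only bounds the number of
  -- common points of distinct lines by one, and `intro` and `elim` then decide between none and
  -- one.
  common-sound : allᵇ lines (λ l → commonᵇ (pointsOf l) l) ≡ true →
    (∀ {p} l m → I p l ≡ true → I p m ≡ true → meets m l ≡ true) →
    (∀ l m → meets m l ≡ true → ∃ λ p → I p l ≡ true × I p m ≡ true) →
    ∀ l m → ∑ points (λ p → 𝟙 (I p l) * 𝟙 (I p m)) ≡ 𝟙 (not (m ==L l) ∧ meets m l) + 5 * 𝟙 (m ==L l)
  common-sound h intro elim l m = trans (sym (∑-filterᵇ points (λ p → I p l) _))
    (count (allᵇ-sound {f = λ m → if m ==L l then c m ≡ᵇ 5 else c m <ᵇ 2}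
      (allᵇ-sound {f = λ l → commonᵇ (pointsOf l) l} h (all-lines l)) (all-lines m)))
    where
    c : Line → ℕ
    c m = ∑ (pointsOf l) (λ p → 𝟙 (I p m))
    one : ∀ {n} → 1 ≤ n → (n <ᵇ 2) ≡ true → n ≡ 1
    one {suc zero} _ _ = refl
    none : (1 ≤ c m → ⊥) → c m ≡ 0
    none h with c m
    ... | zero  = refl
    ... | suc _ = ⊥-elim (h (s≤s z≤n))
    count : (if m ==L l then c m ≡ᵇ 5 else c m <ᵇ 2) ≡ true →
            c m ≡ 𝟙 (not (m ==L l) ∧ meets m l) + 5 * 𝟙 (m ==L l)
    count h with m ==L l
    ... | true  = ≡ᵇ-sound h
    ... | false with meets m l in meet
    ...   | true  = one (let p , pl , pm = elim l m meet in
                         subst (λ b → 𝟙 b ≤ c m) pm (≤∑ (λ p → 𝟙 (I p m)) (∈-filterᵇ⁺ (λ p → I p l) (all-points p) pl))) h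
    ...   | false = none λ pos → let p , p∈ , pm = ∑-positive (pointsOf l) _ pos in
                      contradiction (trans (sym (intro l m (∈-filterᵇ⁻ {xs = points} (λ p → I p l) p∈) (true! _ pm))) meet) (λ ())
      where
      true! : ∀ b → 1 ≤ 𝟙 b → b ≡ true
      true! true _ = refl

-- Two lines lie in as many common planes as they have common points.
common-dual : ∀ points (I J : Pt → Line → Bool) (K : Pt → Pt → Bool) →
  (∀ l π → ∑ points (λ p → 𝟙 (I p l) * 𝟙 (K p π)) ≡ 1 + 4 * 𝟙 (J π l)) →
  (∀ l p → ∑ points (λ π → 𝟙 (J π l) * 𝟙 (K p π)) ≡ 1 + 4 * 𝟙 (I p l)) →
  (∀ l m → ∑ points (λ p → 𝟙 (I p m)) ≡ ∑ points (λ π → 𝟙 (J π l))) →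
  ∀ l m → ∑ points (λ p → 𝟙 (I p l) * 𝟙 (I p m)) ≡ ∑ points (λ π → 𝟙 (J π l) * 𝟙 (J π m))
common-dual points I J K section section′ sizes l m =
  *-cancelˡ-≡ _ _ 4 (+-cancelˡ-≡ (∑ points (λ p → 𝟙 (I p m))) _ _ (begin
    ∑ points (λ p → 𝟙 (I p m)) + 4 * ∑ points (λ p → 𝟙 (I p l) * 𝟙 (I p m))
      ≡⟨ expand (λ p → 𝟙 (I p m)) (λ p → 𝟙 (I p l)) ⟨
    ∑ points (λ p → 𝟙 (I p m) * (1 + 4 * 𝟙 (I p l)))
      ≡⟨ ∑-cong points (λ p → cong (𝟙 (I p m) *_) (sym (section′ l p))) ⟩
    ∑ points (λ p → 𝟙 (I p m) * ∑ points (λ π → 𝟙 (J π l) * 𝟙 (K p π)))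
      ≡⟨ ∑-cong points (λ p → cong (𝟙 (I p m) *_) (∑-cong points λ π → *-comm (𝟙 (J π l)) _)) ⟩
    ∑ points (λ p → 𝟙 (I p m) * ∑ points (λ π → 𝟙 (K p π) * 𝟙 (J π l)))
      ≡⟨ ∑-exchange points points (λ p → 𝟙 (I p m)) (λ p π → 𝟙 (K p π)) (λ π → 𝟙 (J π l)) ⟩
    ∑ points (λ π → ∑ points (λ p → 𝟙 (I p m) * 𝟙 (K p π)) * 𝟙 (J π l))
      ≡⟨ ∑-cong points (λ π → trans (cong (_* 𝟙 (J π l)) (section m π)) (*-comm (1 + 4 * 𝟙 (J π m)) _)) ⟩
    ∑ points (λ π → 𝟙 (J π l) * (1 + 4 * 𝟙 (J π m)))
      ≡⟨ expand (λ π → 𝟙 (J π l)) (λ π → 𝟙 (J π m)) ⟩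
    ∑ points (λ π → 𝟙 (J π l)) + 4 * ∑ points (λ π → 𝟙 (J π m) * 𝟙 (J π l))
      ≡⟨ cong₂ (λ a b → a + 4 * b) (sym (sizes l m)) (∑-cong points λ π → *-comm (𝟙 (J π m)) _) ⟩
    ∑ points (λ p → 𝟙 (I p m)) + 4 * ∑ points (λ π → 𝟙 (J π l) * 𝟙 (J π m)) ∎))
  where
  open ≡-Reasoning
  expand : ∀ (f g : Pt → ℕ) → ∑ points (λ p → f p * (1 + 4 * g p)) ≡ ∑ points f + 4 * ∑ points (λ p → g p * f p)
  expand f g = trans (∑-cong points (λ p → distr (f p) (g p)))
    (trans (∑-+ points f _) (cong (∑ points f +_) (∑-*ˡ points 4 _)))
    where
    distr : ∀ a b → a * (1 + 4 * b) ≡ a + 4 * (b * a)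
    distr = solve-∀

-- `D` runs the same checks with points and planes exchanged. Flags and pencils are self-dual, and
-- common planes reduce to common points by `common-dual`, so these are tested on one side.
record Verified (points : List Pt) (lines : List Line)
                (all-points : ∀ p → p ∈ points) (all-lines : ∀ l → l ∈ lines)
                (I J : Pt → Line → Bool) (K : Pt → Pt → Bool) : Set where
  module P = Checks points lines all-points all-lines I J K
  module D = Checks points lines all-points all-lines J I (λ π p → K p π)
  field
    points-distinct : distinctᵇ _==P_ points ≡ true
    lines-distinct  : distinctᵇ _==L_ lines ≡ true
    lines-number    : length lines ≡ 357
    size₁           : allᵇ lines P.sizeᵇ ≡ true
    size₂           : allᵇ lines D.sizeᵇ ≡ true
    section₁        : allᵇ lines (λ l → P.sectionᵇ (P.pointsOf l) l) ≡ true
    section₂        : allᵇ lines (λ l → D.sectionᵇ (D.pointsOf l) l) ≡ true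
    join₁           : allᵇ points (λ p → P.joinᵇ (P.linesThrough p) p) ≡ true
    join₂           : allᵇ points (λ p → D.joinᵇ (D.linesThrough p) p) ≡ true
    separate₁       : allᵇ points P.separateᵇ ≡ true
    separate₂       : allᵇ points D.separateᵇ ≡ true
    flag₁           : allᵇ lines (λ l → P.flagᵇ (P.pointsOf l) l) ≡ true
    pencil₁         : allᵇ points (λ p → P.pencilᵇ (P.linesThrough p) p) ≡ true
    common₁         : allᵇ lines (λ l → P.commonᵇ (P.pointsOf l) l) ≡ true
    intro           : ∀ {p} l m → I p l ≡ true → I p m ≡ true → meets l m ≡ true
    elim            : ∀ l m → meets l m ≡ true → ∃ λ p → I p l ≡ true × I p m ≡ true

  space : Space points lines I J K
  space = record
    { all-points    = all-points
    ; points-unique = distinctᵇ-sound _==P_ ==P-refl points points-distinct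
    ; all-lines     = all-lines
    ; lines-unique  = distinctᵇ-sound _==L_ ==L-refl lines lines-distinct
    ; lines-number  = lines-number
    ; section       = section
    ; section′      = section′
    ; flag          = P.flag-sound flag₁
    ; join          = P.join-sound join₁
    ; join′         = D.join-sound join₂
    ; size          = size
    ; size′         = size′
    ; pencil        = P.pencil-sound pencil₁
    ; separate      = P.separate-sound separate₁
    ; separate′     = D.separate-sound separate₂
    ; common        = common
    ; common′       = λ l m → trans
        (sym (common-dual points I J K section section′ (λ l m → trans (size m) (sym (size′ l))) l m))
        (common l m)
    }
    where
    section  = P.section-sound section₁
    section′ = D.section-sound section₂
    size     = P.size-sound size₁
    size′    = D.size-sound size₂
    common   = P.common-sound common₁
      (λ l m pl pm → intro m l pm pl)
      (λ l m h → let p , pm , pl = elim m l h in p , pl , pm)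

-- Each `refl` makes the type checker evaluate a finite check; only the link between `meets` and
-- common points is proved by algebra.
PG34 : Verified allPts allLines ∈allPts ∈allLines onLine onPlane incident
PG34 = record
  { points-distinct = refl ; lines-distinct = refl ; lines-number = refl
  ; size₁ = refl ; size₂ = refl ; section₁ = refl ; section₂ = refl
  ; join₁ = refl ; join₂ = refl ; separate₁ = refl ; separate₂ = refl
  ; flag₁ = refl ; pencil₁ = refl ; common₁ = refl
  ; intro = λ {p} → meets-intro {p} ; elim = meets-elim
  }

-- Counting identities of a Cameron–Liebler line class

𝟙-idem : ∀ b → 𝟙 b * 𝟙 b ≡ 𝟙 b
𝟙-idem true  = refl
𝟙-idem false = refl

𝟙≤1 : ∀ b → 𝟙 b ≤ 1
𝟙≤1 true  = ≤-refl
𝟙≤1 false = z≤n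

𝟙-true : ∀ {b} → 1 ≤ 𝟙 b → b ≡ true
𝟙-true {true} _ = refl

∑-linear : ∀ (xs : List A) (f g : A → ℕ) a b →
  ∑ xs (λ y → f y * (a + b * g y)) ≡ a * ∑ xs f + b * ∑ xs (λ y → f y * g y)
∑-linear xs f g a b = begin
  ∑ xs (λ y → f y * (a + b * g y))                       ≡⟨ ∑-cong xs (λ y → distr (f y) (g y) a b) ⟩
  ∑ xs (λ y → a * f y + b * (f y * g y))                 ≡⟨ ∑-+ xs _ _ ⟩
  ∑ xs (λ y → a * f y) + ∑ xs (λ y → b * (f y * g y))    ≡⟨ cong₂ _+_ (∑-*ˡ xs a f) (∑-*ˡ xs b _) ⟩
  a * ∑ xs f + b * ∑ xs (λ y → f y * g y)                ∎
  where
  open ≡-Reasoning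
  distr : ∀ f g a b → f * (a + b * g) ≡ a * f + b * (f * g)
  distr = solve-∀

-- The defining equation for q = 4, with 5 = q + 1 and 15 = q² - 1. It mentions neither points nor
-- planes, so one proof of it serves a space and its dual.
IsClass : List Line → LineSet → ℕ → Set
IsClass lines L x = ∀ l → ∑ lines (λ m → 𝟙 (not (m ==L l) ∧ meets m l) * 𝟙 (L m)) ≡ 5 * x + 15 * 𝟙 (L l)

module PointCounts {points lines I J K} (S : Space points lines I J K)
                   (L : LineSet) (x : ℕ) (cl : IsClass lines L x) where
  open Space S
  open ≡-Reasoning

  n N : Pt → ℕ
  n p = ∑ lines λ l → 𝟙 (I p l) * 𝟙 (L l)
  N π = ∑ lines λ l → 𝟙 (J π l) * 𝟙 (L l)

  ∣L∣ : ℕ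
  ∣L∣ = ∑ lines λ l → 𝟙 (L l)

  through : ∀ p → ∑ lines (λ l → 𝟙 (I p l)) ≡ 21
  through p = begin
    ∑ lines (λ l → 𝟙 (I p l))             ≡⟨ ∑-cong lines (λ l → sym (𝟙-idem (I p l))) ⟩
    ∑ lines (λ l → 𝟙 (I p l) * 𝟙 (I p l)) ≡⟨ join p p ⟩
    1 + 20 * 𝟙 (p ==P p)                  ≡⟨ cong (λ b → 1 + 20 * 𝟙 b) (==P-refl p) ⟩
    21                                    ∎

  -- A class line meeting `l` is counted at one point, and `l` itself, if in the class, at five
  -- points; this raises 15 to 20.
  line-sum : ∀ l → ∑ points (λ p → 𝟙 (I p l) * n p) ≡ 5 * x + 20 * 𝟙 (L l)
  line-sum l = begin
    ∑ points (λ p → 𝟙 (I p l) * n p)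
      ≡⟨ ∑-exchange points lines (λ p → 𝟙 (I p l)) _ _ ⟩
    ∑ lines (λ m → ∑ points (λ p → 𝟙 (I p l) * 𝟙 (I p m)) * 𝟙 (L m))
      ≡⟨ ∑-cong lines (λ m → trans (cong (_* 𝟙 (L m)) (common l m)) (distr (adj m) (𝟙 (m ==L l)) (𝟙 (L m)))) ⟩
    ∑ lines (λ m → adj m * 𝟙 (L m) + 5 * (𝟙 (m ==L l) * 𝟙 (L m)))
      ≡⟨ ∑-+ lines _ _ ⟩
    ∑ lines (λ m → adj m * 𝟙 (L m)) + ∑ lines (λ m → 5 * (𝟙 (m ==L l) * 𝟙 (L m)))
      ≡⟨ cong₂ _+_ (cl l) (trans (∑-*ˡ lines 5 _) (cong (5 *_)
           (∑-δ (λ m → m ==L l) (λ m → 𝟙 (L m)) lines-unique (all-lines l) (==L-refl l) (λ m h → sym (==L-sound m l h))))) ⟩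
    5 * x + 15 * 𝟙 (L l) + 5 * 𝟙 (L l)
      ≡⟨ collect (5 * x) (𝟙 (L l)) ⟩
    5 * x + 20 * 𝟙 (L l) ∎
    where
    adj : Line → ℕ
    adj m = 𝟙 (not (m ==L l) ∧ meets m l)
    distr : ∀ a b c → (a + 5 * b) * c ≡ a * c + 5 * (b * c)
    distr = solve-∀
    collect : ∀ a b → a + 15 * b + 5 * b ≡ a + 20 * b
    collect = solve-∀

  total : ∑ points n ≡ 5 * ∣L∣
  total = begin
    ∑ points n                                              ≡⟨ ∑-swap points lines _ ⟩
    ∑ lines (λ l → ∑ points (λ p → 𝟙 (I p l) * 𝟙 (L l)))    ≡⟨ ∑-cong lines (λ l → trans (∑-*ʳ points _ _) (cong (_* 𝟙 (L l)) (size l))) ⟩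
    ∑ lines (λ l → 5 * 𝟙 (L l))                             ≡⟨ ∑-*ˡ lines 5 _ ⟩
    5 * ∣L∣                                                 ∎

  -- Double count of incident pairs of a point and a line, weighted by `n`: each point lies on 21
  -- lines, and `line-sum` applies to all 357 lines.
  cardinality : ∣L∣ ≡ 21 * x
  cardinality = *-cancelˡ-≡ _ _ 85 (+-cancelʳ-≡ (20 * ∣L∣) _ _ (begin
    85 * ∣L∣ + 20 * ∣L∣                                       ≡⟨ left ∣L∣ ⟩
    21 * (5 * ∣L∣)                                            ≡⟨ cong (21 *_) total ⟨
    21 * ∑ points n                                           ≡⟨ ∑-*ˡ points 21 n ⟨
    ∑ points (λ p → 21 * n p)                                 ≡⟨ ∑-cong points (λ p → cong (_* n p) (through p)) ⟨
    ∑ points (λ p → ∑ lines (λ l → 𝟙 (I p l)) * n p)          ≡⟨ ∑-cong points (λ p → sym (∑-*ʳ lines (n p) _)) ⟩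
    ∑ points (λ p → ∑ lines (λ l → 𝟙 (I p l) * n p))          ≡⟨ ∑-swap points lines _ ⟩
    ∑ lines (λ l → ∑ points (λ p → 𝟙 (I p l) * n p))          ≡⟨ ∑-cong lines line-sum ⟩
    ∑ lines (λ l → 5 * x + 20 * 𝟙 (L l))                      ≡⟨ ∑-+ lines _ _ ⟩
    ∑ lines (λ l → 5 * x) + ∑ lines (λ l → 20 * 𝟙 (L l))      ≡⟨ cong₂ _+_ (trans (∑-const lines (5 * x)) (cong (_* (5 * x)) lines-number)) (∑-*ˡ lines 20 _) ⟩
    357 * (5 * x) + 20 * ∣L∣                                  ≡⟨ cong (_+ 20 * ∣L∣) (right x) ⟩
    85 * (21 * x) + 20 * ∣L∣                                  ∎))
    where
    left : ∀ a → 85 * a + 20 * a ≡ 21 * (5 * a)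
    left = solve-∀
    right : ∀ a → 357 * (5 * a) ≡ 85 * (21 * a)
    right = solve-∀

  -- Each class line meets π in one point, or in four further ones if it lies in π.
  plane-sum : ∀ π → ∑ points (λ p → 𝟙 (K p π) * n p) ≡ 21 * x + 4 * N π
  plane-sum π = begin
    ∑ points (λ p → 𝟙 (K p π) * n p)
      ≡⟨ ∑-exchange points lines (λ p → 𝟙 (K p π)) _ _ ⟩
    ∑ lines (λ l → ∑ points (λ p → 𝟙 (K p π) * 𝟙 (I p l)) * 𝟙 (L l))
      ≡⟨ ∑-cong lines (λ l → trans (cong (_* 𝟙 (L l)) (trans (∑-cong points λ p → *-comm (𝟙 (K p π)) _) (section l π)))
           (distr (𝟙 (J π l)) (𝟙 (L l)))) ⟩
    ∑ lines (λ l → 𝟙 (L l) + 4 * (𝟙 (J π l) * 𝟙 (L l)))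
      ≡⟨ trans (∑-+ lines _ _) (cong₂ _+_ cardinality (∑-*ˡ lines 4 _)) ⟩
    21 * x + 4 * N π ∎
    where
    distr : ∀ a b → (1 + 4 * a) * b ≡ b + 4 * (a * b)
    distr = solve-∀

  -- One factor `n p` is expanded into the class lines through `p`, and on each of them `n` sums to
  -- 5x + 20.
  square-total : ∑ points (λ p → n p * n p) ≡ (5 * x + 20) * (21 * x)
  square-total = begin
    ∑ points (λ p → n p * n p)
      ≡⟨ ∑-exchange points lines n _ _ ⟩
    ∑ lines (λ l → ∑ points (λ p → n p * 𝟙 (I p l)) * 𝟙 (L l))
      ≡⟨ ∑-cong lines (λ l → trans (cong (_* 𝟙 (L l)) (trans (∑-cong points λ p → *-comm (n p) _) (line-sum l)))
           (on-class (L l))) ⟩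
    ∑ lines (λ l → (5 * x + 20) * 𝟙 (L l))
      ≡⟨ trans (∑-*ˡ lines (5 * x + 20) _) (cong ((5 * x + 20) *_) cardinality) ⟩
    (5 * x + 20) * (21 * x) ∎
    where
    on-class : ∀ b → (5 * x + 20 * 𝟙 b) * 𝟙 b ≡ (5 * x + 20) * 𝟙 b
    on-class true  = refl
    on-class false = trans (*-zeroʳ (5 * x + 0)) (sym (*-zeroʳ (5 * x + 20)))

  n≤21 : ∀ p → n p ≤ 21
  n≤21 p = subst (n p ≤_) (through p) (∑-mono∈ lines λ {l} _ →
    ≤-trans (*-monoʳ-≤ (𝟙 (I p l)) (𝟙≤1 (L l))) (≤-reflexive (*-identityʳ _)))

  outside-number : ∀ p → n p + ∑ lines (λ l → 𝟙 (I p l) * 𝟙 (not (L l))) ≡ 21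
  outside-number p = begin
    n p + ∑ lines (λ l → 𝟙 (I p l) * 𝟙 (not (L l)))                   ≡⟨ sym (∑-+ lines _ _) ⟩
    ∑ lines (λ l → 𝟙 (I p l) * 𝟙 (L l) + 𝟙 (I p l) * 𝟙 (not (L l)))  ≡⟨ ∑-cong lines (λ l → merge (𝟙 (I p l)) (L l)) ⟩
    ∑ lines (λ l → 𝟙 (I p l))                                         ≡⟨ through p ⟩
    21                                                                ∎
    where
    merge : ∀ a b → a * 𝟙 b + a * 𝟙 (not b) ≡ a
    merge a true  = trans (cong₂ _+_ (*-identityʳ a) (*-zeroʳ a)) (+-identityʳ a)
    merge a false = cong₂ _+_ (*-zeroʳ a) (*-identityʳ a)

  outside-line : ∀ p → n p < 21 → ∃ λ l → I p l ≡ true × L l ≡ false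
  outside-line p n<21
    with l , _ , pos ← ∑-positive lines _ (+-cancelˡ-≤ (n p) 1 _
           (subst₂ _≤_ (+-comm 1 (n p)) (sym (outside-number p)) n<21))
    = l , both (I p l) (L l) pos
    where
    both : ∀ a b → 1 ≤ 𝟙 a * 𝟙 (not b) → a ≡ true × b ≡ false
    both true false _ = refl , refl

  -- The bound is 357 / 21 = 17: below it the 21x lines of the class are not all lines.
  outside-exists : x < 17 → ∃ λ l → L l ≡ false
  outside-exists x<17 = let l , _ , pos = ∑-positive lines (λ l → 𝟙 (not (L l))) positive in l , conclude (L l) pos
    where
    conclude : ∀ b → 1 ≤ 𝟙 (not b) → b ≡ false
    conclude false _ = refl
    merge : ∀ b → 𝟙 b + 𝟙 (not b) ≡ 1
    merge true  = refl
    merge false = refl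
    both : 21 * x + ∑ lines (λ l → 𝟙 (not (L l))) ≡ 357
    both = begin
      21 * x + ∑ lines (λ l → 𝟙 (not (L l)))    ≡⟨ cong (_+ ∑ lines (λ l → 𝟙 (not (L l)))) cardinality ⟨
      ∣L∣ + ∑ lines (λ l → 𝟙 (not (L l)))       ≡⟨ sym (∑-+ lines _ _) ⟩
      ∑ lines (λ l → 𝟙 (L l) + 𝟙 (not (L l)))   ≡⟨ ∑-cong lines (λ l → merge (L l)) ⟩
      ∑ lines (λ _ → 1)                         ≡⟨ ∑-const lines 1 ⟩
      length lines * 1                          ≡⟨ cong (_* 1) lines-number ⟩
      357                                       ∎
    positive : 1 ≤ ∑ lines (λ l → 𝟙 (not (L l)))
    positive = +-cancelˡ-≤ (21 * x) 1 _ (≤-trans (≤-reflexive (+-comm (21 * x) 1))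
      (≤-trans (*-monoʳ-< 21 x<17) (≤-reflexive (sym both))))

  inside-line : ∀ p → 1 ≤ n p → ∃ λ l → I p l ≡ true × L l ≡ true
  inside-line p n≥1 with l , _ , pos ← ∑-positive lines _ n≥1 = l , both (I p l) (L l) pos
    where
    both : ∀ a b → 1 ≤ 𝟙 a * 𝟙 b → a ≡ true × b ≡ true
    both true true _ = refl , refl

  outside : ∀ {p l} → n p ≡ 0 → I p l ≡ true → L l ≡ false
  outside {p} {l} n≡0 pl with L l in Ll
  ... | false = refl
  ... | true  = contradiction (≤-trans (≤-reflexive (sym (cong₂ (λ a b → 𝟙 a * 𝟙 b) pl Ll)))
                  (≤∑ (λ l → 𝟙 (I p l) * 𝟙 (L l)) (all-lines l))) (λ h → contradiction (subst (1 ≤_) n≡0 h) λ ())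

  full : ∀ {p l} → n p ≡ 21 → I p l ≡ true → L l ≡ true
  full {p} {l} n≡21 pl = conclude (L l) (≤-trans (≤-reflexive (cong (λ a → 𝟙 a * 𝟙 (not (L l))) (sym pl)))
    (subst (𝟙 (I p l) * 𝟙 (not (L l)) ≤_) none (≤∑ (λ l → 𝟙 (I p l) * 𝟙 (not (L l))) (all-lines l))))
    where
    none : ∑ lines (λ l → 𝟙 (I p l) * 𝟙 (not (L l))) ≡ 0
    none = +-cancelˡ-≡ 21 _ _ (trans (cong (_+ ∑ lines (λ l → 𝟙 (I p l) * 𝟙 (not (L l)))) (sym n≡21)) (outside-number p))
    conclude : ∀ b → 1 * 𝟙 (not b) ≤ 0 → b ≡ true
    conclude true _ = refl

  outside-other : ∀ {p} l₀ l → n p ≡ 1 → I p l₀ ≡ true → L l₀ ≡ true → I p l ≡ true → l₀ ≢ l → L l ≡ false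
  outside-other {p} l₀ l n≡1 pl₀ Ll₀ pl l₀≢l = conclude (L l) (+-cancelˡ-≤ 1 _ 0 (subst₂ _≤_
    (cong₂ (λ a b → a + b * 𝟙 (L l)) (cong₂ (λ a b → 𝟙 a * 𝟙 b) pl₀ Ll₀) (cong 𝟙 pl))
    (trans (sym (sum _)) n≡1)
    (+-monoʳ-≤ (𝟙 (I p l₀) * 𝟙 (L l₀)) (≤∑ (λ l → 𝟙 (I p l) * 𝟙 (L l)) (stays (all-lines l) l₀≢l)))))
    where
    open Removal (remove lines-unique (all-lines l₀))
    conclude : ∀ b → 1 * 𝟙 b ≤ 0 → b ≡ false
    conclude false _ = refl

-- Identities that involve points and planes together

module Counts {points lines I J K} (S : Space points lines I J K)
              (L : LineSet) (x : ℕ) (cl : IsClass lines L x) where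
  open Space S
  open PointCounts S L x cl public
  open PointCounts (dual S) L x cl public using ()
    renaming (through to through′; line-sum to line-sum′; n≤21 to N≤21;
              outside-line to outside-line′; inside-line to inside-line′; outside to outside′;
              full to full′; outside-other to outside-other′)
  open ≡-Reasoning

  pen : Pt → Pt → ℕ
  pen p π = ∑ lines λ l → 𝟙 (I p l) * (𝟙 (J π l) * 𝟙 (L l))

  -- Two distinct common points rule out the value 1 in `section`.
  line-in-plane : ∀ {p q l π} → p ≢ q → I p l ≡ true → I q l ≡ true → K p π ≡ true → K q π ≡ true → J π l ≡ true
  line-in-plane {p} {q} {l} {π} p≢q pl ql pπ qπ = conclude (J π l) (subst (2 ≤_) (section l π) (subst (2 ≤_) (sym (sum _))
    (+-mono-≤ (≤-reflexive (sym (cong₂ (λ a b → 𝟙 a * 𝟙 b) pl pπ)))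
      (≤-trans (≤-reflexive (sym (cong₂ (λ a b → 𝟙 a * 𝟙 b) ql qπ))) (≤∑ _ (stays (all-points q) p≢q))))))
    where
    open Removal (remove points-unique (all-points p))
    conclude : ∀ b → 2 ≤ 1 + 4 * 𝟙 b → b ≡ true
    conclude true  _ = refl
    conclude false (s≤s ())

  -- The five lines of the pencil cover each point of π other than `p` once and `p` itself five
  -- times, hence the extra 4.
  flag-join : ∀ {p π} → K p π ≡ true → ∀ q →
    ∑ lines (λ l → 𝟙 (I p l) * 𝟙 (J π l) * 𝟙 (I q l)) ≡ 𝟙 (K q π) + 4 * 𝟙 (p ==P q)
  flag-join {p} {π} pπ q with p ==P q in p==q
  ... | true with refl ← ==P-sound p q p==q = begin
    ∑ lines (λ l → 𝟙 (I p l) * 𝟙 (J π l) * 𝟙 (I p l)) ≡⟨ ∑-cong lines (λ l → absorb (I p l) (𝟙 (J π l))) ⟩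
    ∑ lines (λ l → 𝟙 (I p l) * 𝟙 (J π l))             ≡⟨ pencil pπ ⟩
    5                                                 ≡⟨ cong (λ b → 𝟙 b + 4) pπ ⟨
    𝟙 (K p π) + 4                                     ∎
    where
    absorb : ∀ a b → 𝟙 a * b * 𝟙 a ≡ 𝟙 a * b
    absorb true  b = *-identityʳ _
    absorb false b = refl
  ... | false with K q π in qπ
  ...   | true = begin
    ∑ lines (λ l → 𝟙 (I p l) * 𝟙 (J π l) * 𝟙 (I q l)) ≡⟨ ∑-cong lines (λ l → redundant (I p l) (J π l) (I q l)
      (λ pl ql → line-in-plane p≢q pl ql pπ qπ)) ⟩
    ∑ lines (λ l → 𝟙 (I p l) * 𝟙 (I q l))             ≡⟨ join p q ⟩
    1 + 20 * 𝟙 (p ==P q)                              ≡⟨ cong (λ b → 1 + 20 * 𝟙 b) p==q ⟩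
    1                                                 ∎
    where
    p≢q : p ≢ q
    p≢q refl = contradiction (trans (sym p==q) (==P-refl p)) λ ()
    redundant : ∀ a b c → (a ≡ true → c ≡ true → b ≡ true) → 𝟙 a * 𝟙 b * 𝟙 c ≡ 𝟙 a * 𝟙 c
    redundant false _     _     _ = refl
    redundant true  true  _     _ = refl
    redundant true  false false _ = refl
    redundant true  false true  h = contradiction (h refl refl) λ ()
  ...   | false = trans (∑-cong lines λ l → empty (I p l) (J π l) (I q l)
      (λ πl ql → contradiction (trans (sym (flag ql πl)) qπ) λ ())) (∑-zero lines)
    where
    empty : ∀ a b c → (b ≡ true → c ≡ true → ⊥) → 𝟙 a * 𝟙 b * 𝟙 c ≡ 0
    empty false _     _     _ = refl
    empty true  false _     _ = refl
    empty true  true  false _ = refl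
    empty true  true  true  h = ⊥-elim (h refl refl)

  -- The `line-sum` identities of the five lines in the pencil add up to the `plane-sum` of π plus
  -- four times `n p`; the factor 4 then cancels.
  pencil-size : ∀ {p π} → K p π ≡ true → N π + n p ≡ x + 5 * pen p π
  pencil-size {p} {π} pπ = *-cancelˡ-≡ _ _ 4 (+-cancelˡ-≡ (21 * x) _ _ (begin
    21 * x + 4 * (N π + n p)
      ≡⟨ assoc (21 * x) (N π) (n p) ⟩
    21 * x + 4 * N π + 4 * n p
      ≡⟨ cong₂ (λ a b → a + 4 * b) (plane-sum π)
           (∑-δ (p ==P_) n points-unique (all-points p) (==P-refl p) (λ q → ==P-sound p q)) ⟨
    ∑ points (λ q → 𝟙 (K q π) * n q) + 4 * ∑ points (λ q → 𝟙 (p ==P q) * n q)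
      ≡⟨ cong (∑ points (λ q → 𝟙 (K q π) * n q) +_) (sym (∑-*ˡ points 4 _)) ⟩
    ∑ points (λ q → 𝟙 (K q π) * n q) + ∑ points (λ q → 4 * (𝟙 (p ==P q) * n q))
      ≡⟨ sym (∑-+ points _ _) ⟩
    ∑ points (λ q → 𝟙 (K q π) * n q + 4 * (𝟙 (p ==P q) * n q))
      ≡⟨ ∑-cong points (λ q → trans (factor (𝟙 (K q π)) (𝟙 (p ==P q)) (n q)) (cong (_* n q) (sym (flag-join pπ q)))) ⟩
    ∑ points (λ q → ∑ lines (λ l → 𝟙 (I p l) * 𝟙 (J π l) * 𝟙 (I q l)) * n q)
      ≡⟨ ∑-exchange lines points (λ l → 𝟙 (I p l) * 𝟙 (J π l)) _ n ⟨
    ∑ lines (λ l → 𝟙 (I p l) * 𝟙 (J π l) * ∑ points (λ q → 𝟙 (I q l) * n q))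
      ≡⟨ ∑-cong lines (λ l → cong (𝟙 (I p l) * 𝟙 (J π l) *_) (line-sum l)) ⟩
    ∑ lines (λ l → 𝟙 (I p l) * 𝟙 (J π l) * (5 * x + 20 * 𝟙 (L l)))
      ≡⟨ ∑-linear lines _ (λ l → 𝟙 (L l)) (5 * x) 20 ⟩
    5 * x * ∑ lines (λ l → 𝟙 (I p l) * 𝟙 (J π l)) + 20 * ∑ lines (λ l → 𝟙 (I p l) * 𝟙 (J π l) * 𝟙 (L l))
      ≡⟨ cong₂ (λ a b → 5 * x * a + 20 * b) (pencil pπ) (∑-cong lines (λ l → *-assoc (𝟙 (I p l)) _ _)) ⟩
    5 * x * 5 + 20 * pen p π
      ≡⟨ collect x (pen p π) ⟩
    21 * x + 4 * (x + 5 * pen p π) ∎))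
    where
    assoc : ∀ a b c → a + 4 * (b + c) ≡ a + 4 * b + 4 * c
    assoc = solve-∀
    factor : ∀ a b c → a * c + 4 * (b * c) ≡ (a + 4 * b) * c
    factor = solve-∀
    collect : ∀ a b → 5 * a * 5 + 20 * b ≡ 21 * a + 4 * (a + 5 * b)
    collect = solve-∀

  -- `pencil-size` is multiplied by `n p` and summed over π. The sum of `n p * pen p π` runs over
  -- the class lines in π, each contributing 5x + 20.
  plane-square-sum : ∀ π →
    ∑ points (λ p → 𝟙 (K p π) * (n p * n p)) + N π * (21 * x + 4 * N π)
      ≡ x * (21 * x + 4 * N π) + 5 * ((5 * x + 20) * N π)
  plane-square-sum π = begin
    ∑ points (λ p → k p * (n p * n p)) + N π * (21 * x + 4 * N π)
      ≡⟨ cong (λ a → ∑ points (λ p → k p * (n p * n p)) + N π * a) (sym (plane-sum π)) ⟩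
    ∑ points (λ p → k p * (n p * n p)) + N π * ∑ points (λ p → k p * n p)
      ≡⟨ cong (∑ points (λ p → k p * (n p * n p)) +_) (sym (∑-*ˡ points (N π) _)) ⟩
    ∑ points (λ p → k p * (n p * n p)) + ∑ points (λ p → N π * (k p * n p))
      ≡⟨ sym (∑-+ points _ _) ⟩
    ∑ points (λ p → k p * (n p * n p) + N π * (k p * n p))
      ≡⟨ ∑-cong points (λ p → multiply p (K p π) pencil-size) ⟩
    ∑ points (λ p → k p * n p * (x + 5 * pen p π))
      ≡⟨ ∑-linear points _ (λ p → pen p π) x 5 ⟩
    x * ∑ points (λ p → k p * n p) + 5 * ∑ points (λ p → k p * n p * pen p π)
      ≡⟨ cong₂ (λ a b → x * a + 5 * b) (plane-sum π) pen-sum ⟩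
    x * (21 * x + 4 * N π) + 5 * ((5 * x + 20) * N π) ∎
    where
    k : Pt → ℕ
    k p = 𝟙 (K p π)
    multiply : ∀ p b → (b ≡ true → N π + n p ≡ x + 5 * pen p π) →
      𝟙 b * (n p * n p) + N π * (𝟙 b * n p) ≡ 𝟙 b * n p * (x + 5 * pen p π)
    multiply p false _ = *-zeroʳ (N π)
    multiply p true  h = trans (rearrange (n p) (N π)) (cong (1 * n p *_) (h refl))
      where
      rearrange : ∀ a b → 1 * (a * a) + b * (1 * a) ≡ 1 * a * (b + a)
      rearrange = solve-∀
    pen-sum : ∑ points (λ p → k p * n p * pen p π) ≡ (5 * x + 20) * N π
    pen-sum = begin
      ∑ points (λ p → k p * n p * pen p π)
        ≡⟨ ∑-exchange points lines (λ p → k p * n p) _ _ ⟩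
      ∑ lines (λ l → ∑ points (λ p → k p * n p * 𝟙 (I p l)) * (𝟙 (J π l) * 𝟙 (L l)))
        ≡⟨ ∑-cong lines (λ l → on-class l (J π l) (L l) refl refl) ⟩
      ∑ lines (λ l → (5 * x + 20) * (𝟙 (J π l) * 𝟙 (L l)))
        ≡⟨ ∑-*ˡ lines (5 * x + 20) _ ⟩
      (5 * x + 20) * N π ∎
      where
      absorb : ∀ a b c → (b ≡ true → a ≡ true) → 𝟙 a * c * 𝟙 b ≡ 𝟙 b * c
      absorb a     false c _ = *-zeroʳ (𝟙 a * c)
      absorb true  true  c _ = *-identityʳ (1 * c)
      absorb false true  c h = contradiction (h refl) λ ()
      on-class : ∀ l a b → J π l ≡ a → L l ≡ b →
        ∑ points (λ p → k p * n p * 𝟙 (I p l)) * (𝟙 a * 𝟙 b) ≡ (5 * x + 20) * (𝟙 a * 𝟙 b)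
      on-class l false b     _  _  = trans (*-zeroʳ (∑ points _)) (sym (*-zeroʳ (5 * x + 20)))
      on-class l true  false _  _  = trans (*-zeroʳ (∑ points _)) (sym (*-zeroʳ (5 * x + 20)))
      on-class l true  true  πl Ll = cong (_* 1) (begin
        ∑ points (λ p → k p * n p * 𝟙 (I p l)) ≡⟨ ∑-cong points (λ p → absorb (K p π) (I p l) (n p) (λ pl → flag pl πl)) ⟩
        ∑ points (λ p → 𝟙 (I p l) * n p)       ≡⟨ line-sum l ⟩
        5 * x + 20 * 𝟙 (L l)                   ≡⟨ cong (λ b → 5 * x + 20 * 𝟙 b) Ll ⟩
        5 * x + 20                             ∎)

  -- Summing the squares over the planes through l counts every point once, and the points of l five times.
  square-sum : ∀ l → L l ≡ false →
    ∑ points (λ p → 𝟙 (I p l) * (n p * n p)) + ∑ points (λ π → 𝟙 (J π l) * (N π * N π)) ≡ 10 * (x * x) + 20 * x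
  square-sum l Ll = *-cancelˡ-≡ _ _ 4 (+-cancelˡ-≡ ((5 * x + 20) * (21 * x) + 21 * x * (5 * x)) _ _ (begin
    (5 * x + 20) * (21 * x) + 21 * x * (5 * x) + 4 * (A₂ + B₂)
      ≡⟨ regroup ((5 * x + 20) * (21 * x)) (21 * x * (5 * x)) A₂ B₂ ⟩
    ((5 * x + 20) * (21 * x) + 4 * A₂) + (21 * x * (5 * x) + 4 * B₂)
      ≡⟨ cong₂ _+_ (sym all-squares) (sym plane-part) ⟩
    ∑ points (λ π → j π * Q π) + ∑ points (λ π → j π * (N π * (21 * x + 4 * N π)))
      ≡⟨ sym (∑-+ points _ _) ⟩
    ∑ points (λ π → j π * Q π + j π * (N π * (21 * x + 4 * N π)))
      -- With the term quadratic in `N π` on the left, the right side is linear in `N π`, and `N`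
      -- has a known sum over the planes on `l`.
      ≡⟨ ∑-cong points (λ π → trans (sym (*-distribˡ-+ (j π) _ _)) (cong (j π *_) (trans (plane-square-sum π) (linear x (N π))))) ⟩
    ∑ points (λ π → j π * (21 * (x * x) + (29 * x + 100) * N π))
      ≡⟨ ∑-linear points j N (21 * (x * x)) (29 * x + 100) ⟩
    21 * (x * x) * ∑ points j + (29 * x + 100) * ∑ points (λ π → j π * N π)
      ≡⟨ cong₂ (λ a b → 21 * (x * x) * a + (29 * x + 100) * b) (size′ l) N-sum ⟩
    21 * (x * x) * 5 + (29 * x + 100) * (5 * x)
      ≡⟨ final x ⟩
    (5 * x + 20) * (21 * x) + 21 * x * (5 * x) + 4 * (10 * (x * x) + 20 * x) ∎))
    where
    j Q : Pt → ℕ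
    j π = 𝟙 (J π l)
    Q π = ∑ points (λ p → 𝟙 (K p π) * (n p * n p))
    A₂ B₂ : ℕ
    A₂ = ∑ points (λ p → 𝟙 (I p l) * (n p * n p))
    B₂ = ∑ points (λ π → j π * (N π * N π))
    N-sum : ∑ points (λ π → j π * N π) ≡ 5 * x
    N-sum = trans (line-sum′ l) (trans (cong (λ b → 5 * x + 20 * 𝟙 b) Ll) (+-identityʳ (5 * x)))
    all-squares : ∑ points (λ π → j π * Q π) ≡ (5 * x + 20) * (21 * x) + 4 * A₂
    all-squares = begin
      ∑ points (λ π → j π * Q π)
        ≡⟨ ∑-exchange points points j (λ π p → 𝟙 (K p π)) _ ⟩
      ∑ points (λ p → ∑ points (λ π → j π * 𝟙 (K p π)) * (n p * n p))
        ≡⟨ ∑-cong points (λ p → trans (cong (_* (n p * n p)) (section′ l p)) (distr (𝟙 (I p l)) (n p * n p))) ⟩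
      ∑ points (λ p → n p * n p + 4 * (𝟙 (I p l) * (n p * n p)))
        ≡⟨ trans (∑-+ points _ _) (cong₂ _+_ square-total (∑-*ˡ points 4 _)) ⟩
      (5 * x + 20) * (21 * x) + 4 * A₂ ∎
      where
      distr : ∀ a b → (1 + 4 * a) * b ≡ b + 4 * (a * b)
      distr = solve-∀
    plane-part : ∑ points (λ π → j π * (N π * (21 * x + 4 * N π))) ≡ 21 * x * (5 * x) + 4 * B₂
    plane-part = begin
      ∑ points (λ π → j π * (N π * (21 * x + 4 * N π)))
        ≡⟨ ∑-cong points (λ π → sym (*-assoc (j π) _ _)) ⟩
      ∑ points (λ π → j π * N π * (21 * x + 4 * N π))
        ≡⟨ ∑-linear points (λ π → j π * N π) N (21 * x) 4 ⟩
      21 * x * ∑ points (λ π → j π * N π) + 4 * ∑ points (λ π → j π * N π * N π)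
        ≡⟨ cong₂ (λ a b → 21 * x * a + 4 * b) N-sum (∑-cong points λ π → *-assoc (j π) _ _) ⟩
      21 * x * (5 * x) + 4 * B₂ ∎
    regroup : ∀ a b c d → a + b + 4 * (c + d) ≡ (a + 4 * c) + (b + 4 * d)
    regroup = solve-∀
    linear : ∀ a b → a * (21 * a + 4 * b) + 5 * ((5 * a + 20) * b) ≡ 21 * (a * a) + (29 * a + 100) * b
    linear = solve-∀
    final : ∀ a → 21 * (a * a) * 5 + (29 * a + 100) * (5 * a)
      ≡ (5 * a + 20) * (21 * a) + 21 * a * (5 * a) + 4 * (10 * (a * a) + 20 * a)
    final = solve-∀

-- Lists of weights with prescribed sums

search : ∀ {P Q : A → Set} → (∀ x → P x ⊎ Q x) → ∀ (xs : List A) →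
  (∃ λ x → x ∈ xs × P x) ⊎ (∀ {x} → x ∈ xs → Q x)
search d [] = inj₂ λ ()
search d (x ∷ xs) with d x | search d xs
... | inj₁ px | _                 = inj₁ (x , here refl , px)
... | inj₂ _  | inj₁ (y , y∈ , py) = inj₁ (y , there y∈ , py)
... | inj₂ qx | inj₂ qs            = inj₂ λ { (here refl) → qx ; (there y∈) → qs y∈ }

zero-or-positive : ∀ (f : A → ℕ) x → f x ≡ 0 ⊎ 1 ≤ f x
zero-or-positive f x with f x
... | zero  = inj₁ refl
... | suc _ = inj₂ (s≤s z≤n)

all-ones : ∀ {xs : List A} (f : A → ℕ) → Unique xs → (∀ {y} → y ∈ xs → 1 ≤ f y) →
  ∑ xs f ≡ length xs → ∀ {x} → x ∈ xs → f x ≡ 1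
all-ones f u pos h x∈ =
  ≤-antisym (≤-excess f 0 u pos (≤-reflexive (trans h (sym (+-identityʳ _)))) x∈) (pos x∈)

ones-squared : ∀ (xs : List A) (f : A → ℕ) → (∀ {x} → x ∈ xs → f x ≡ 1) → ∑ xs (λ x → f x * f x) ≡ length xs
ones-squared xs f one = trans (∑-cong∈ xs (λ x∈ → cong (λ k → k * k) (one x∈)))
  (trans (∑-const xs 1) (*-identityʳ _))

∑-bound : ∀ (xs : List A) (f : A → ℕ) k → (∀ {x} → x ∈ xs → f x ≤ k) → ∑ xs f ≤ length xs * k
∑-bound xs f k h = ≤-trans (∑-mono∈ xs h) (≤-reflexive (∑-const xs k))

-- The equation is quantified over `f` after `u` and `v` are chosen, so that the linear and the
-- quadratic sum speak of the same two points.
triple-with-rest : ∀ {xs : List A} {p q z} → Unique xs → length xs ≡ 5 → p ∈ xs → q ∈ xs → z ∈ xs →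
  p ≢ q → p ≢ z → q ≢ z → ∃ λ u → ∃ λ v → ∀ f → ∑ xs f ≡ f p + (f q + (f z + (f u + (f v + 0))))
triple-with-rest {p = p} {q} {z} un len p∈ q∈ z∈ p≢q p≢z q≢z
  with record { rest = ps ; sum = sum₁ ; size = size₁ ; stays = stays₁ ; unique = un₁ } ← remove un p∈
  with record { rest = qs ; sum = sum₂ ; size = size₂ ; stays = stays₂ ; unique = un₂ } ← remove un₁ (stays₁ q∈ p≢q)
  with record { rest = zs ; sum = sum₃ ; size = size₃ } ← remove un₂ (stays₂ (stays₁ z∈ p≢z) q≢z)
  with zs | suc-injective (suc-injective (suc-injective (trans (sym (trans size₁ (cong suc (trans size₂ (cong suc size₃))))) len)))
... | u ∷ v ∷ [] | _ = u , v , λ f → trans (sum₁ f) (cong (f p +_) (trans (sum₂ f) (cong (f q +_) (sum₃ f))))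

-- 3 = 0 + 3 = 1 + 2 allows only the square sums 9 and 5.
no-pair : ∀ u v → u + v ≡ 3 → u * u + v * v ≡ 7 → ⊥
no-pair 0 v refl ()
no-pair 1 v refl ()
no-pair 2 v refl ()
no-pair 3 v refl ()
no-pair (suc (suc (suc (suc _)))) v () _

-- Existence statements drawn from the incidence counts

module OnLine {points lines I J K} (S : Space points lines I J K) where
  open Space S

  pointsOn : Line → List Pt
  pointsOn l = filterᵇ (λ p → I p l) points

  pointsOn-unique : ∀ l → Unique (pointsOn l)
  pointsOn-unique l = filter⁺ (T? ∘ λ p → I p l) points-unique

  pointsOn-length : ∀ l → length (pointsOn l) ≡ 5
  pointsOn-length l = trans (length-filterᵇ points _) (size l)

  pointsOn⁺ : ∀ {p} l → I p l ≡ true → p ∈ pointsOn l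
  pointsOn⁺ l = ∈-filterᵇ⁺ (λ p → I p l) (all-points _)

  pointsOn⁻ : ∀ {p} l → p ∈ pointsOn l → I p l ≡ true
  pointsOn⁻ l = ∈-filterᵇ⁻ {xs = points} (λ p → I p l)

  joining-line : ∀ p q → ∃ λ l → I p l ≡ true × I q l ≡ true
  joining-line p q with l , _ , pos ← ∑-positive lines _ (subst (1 ≤_) (sym (join p q)) (s≤s z≤n))
    = l , both (I p l) (I q l) pos
    where
    both : ∀ a b → 1 ≤ 𝟙 a * 𝟙 b → a ≡ true × b ≡ true
    both true true _ = refl , refl

  meeting-point : ∀ l π → ∃ λ p → I p l ≡ true × K p π ≡ true
  meeting-point l π with p , _ , pos ← ∑-positive points _ (subst (1 ≤_) (sym (section l π)) (s≤s z≤n))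
    = p , both (I p l) (K p π) pos
    where
    both : ∀ a b → 1 ≤ 𝟙 a * 𝟙 b → a ≡ true × b ≡ true
    both true true _ = refl , refl

  plane-on : ∀ l → ∃ λ π → J π l ≡ true
  plane-on l with π , _ , pos ← ∑-positive points _ (subst (1 ≤_) (sym (size′ l)) (s≤s z≤n)) = π , 𝟙-true pos

  common-plane : ∀ p q → ∃ λ π → K p π ≡ true × K q π ≡ true
  common-plane p q = let l , pl , ql = joining-line p q ; π , πl = plane-on l in π , flag pl πl , flag ql πl

-- n and N are reduced by the residues c and c′ modulo 5 that all of their values share.
module Weights {points lines I J K} (S : Space points lines I J K)
               (L : LineSet) (x : ℕ) (cl : IsClass lines L x) (c c′ : ℕ) (m m′ : Pt → ℕ)
               (n≡ : ∀ p → PointCounts.n S L x cl p ≡ c + 5 * m p)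
               (N≡ : ∀ π → PointCounts.n (dual S) L x cl π ≡ c′ + 5 * m′ π) where
  open Space S public
  open Counts S L x cl public
  open OnLine S public
  open OnLine (dual S) public using ()
    renaming (pointsOn to planesOn; pointsOn-unique to planesOn-unique; pointsOn-length to planesOn-length;
              pointsOn⁺ to planesOn⁺; pointsOn⁻ to planesOn⁻)
  open ≡-Reasoning

  W W′ A₂ B₂ : Line → ℕ
  W l  = ∑ (pointsOn l) m
  W′ l = ∑ (planesOn l) m′
  A₂ l = ∑ (pointsOn l) (λ p → m p * m p)
  B₂ l = ∑ (planesOn l) (λ π → m′ π * m′ π)

  private
    reduce : ∀ (b : Pt → Bool) (k : Pt → ℕ) (μ : Pt → ℕ) d → (∀ p → k p ≡ d + 5 * μ p) →
      ∑ points (𝟙 ∘ b) ≡ 5 → ∑ points (λ p → 𝟙 (b p) * k p) ≡ 5 * (d + ∑ (filterᵇ b points) μ)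
    reduce b k μ d k≡ five = begin
      ∑ points (λ p → 𝟙 (b p) * k p)             ≡⟨ ∑-cong points (λ p → cong (𝟙 (b p) *_) (k≡ p)) ⟩
      ∑ points (λ p → 𝟙 (b p) * (d + 5 * μ p))   ≡⟨ ∑-linear points _ μ d 5 ⟩
      d * ∑ points (𝟙 ∘ b) + 5 * ∑ points (λ p → 𝟙 (b p) * μ p)
        ≡⟨ cong₂ (λ s t → d * s + 5 * t) five (sym (∑-filterᵇ points b μ)) ⟩
      d * 5 + 5 * ∑ (filterᵇ b points) μ         ≡⟨ factor d _ ⟩
      5 * (d + ∑ (filterᵇ b points) μ)           ∎
      where
      factor : ∀ a b → a * 5 + 5 * b ≡ 5 * (a + b)
      factor = solve-∀

    -- The five points contribute `d * d` each, so a factor 5 comes out of the whole expression; the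
    -- condition modulo 25 thereby becomes one modulo 5.
    reduce² : ∀ (b : Pt → Bool) (k : Pt → ℕ) (μ : Pt → ℕ) d → (∀ p → k p ≡ d + 5 * μ p) →
      ∑ points (𝟙 ∘ b) ≡ 5 → ∑ points (λ p → 𝟙 (b p) * (k p * k p)) ≡
        5 * (d * d + 2 * d * ∑ (filterᵇ b points) μ + 5 * ∑ (filterᵇ b points) (λ p → μ p * μ p))
    reduce² b k μ d k≡ five = begin
      ∑ points (λ p → 𝟙 (b p) * (k p * k p))
        ≡⟨ ∑-cong points (λ p → cong (𝟙 (b p) *_) (trans (cong (λ a → a * a) (k≡ p)) (expand d (μ p)))) ⟩
      ∑ points (λ p → 𝟙 (b p) * (d * d + 5 * (μ p * (2 * d + 5 * μ p))))
        ≡⟨ ∑-linear points _ _ (d * d) 5 ⟩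
      d * d * ∑ points (𝟙 ∘ b) + 5 * ∑ points (λ p → 𝟙 (b p) * (μ p * (2 * d + 5 * μ p)))
        ≡⟨ cong₂ (λ s t → d * d * s + 5 * t) five (sym (∑-filterᵇ points b _)) ⟩
      d * d * 5 + 5 * ∑ (filterᵇ b points) (λ p → μ p * (2 * d + 5 * μ p))
        ≡⟨ cong (λ t → d * d * 5 + 5 * t) (∑-linear (filterᵇ b points) μ μ (2 * d) 5) ⟩
      d * d * 5 + 5 * (2 * d * ∑ (filterᵇ b points) μ + 5 * ∑ (filterᵇ b points) (λ p → μ p * μ p))
        ≡⟨ factor (d * d) (2 * d * ∑ (filterᵇ b points) μ) (∑ (filterᵇ b points) (λ p → μ p * μ p)) ⟩
      5 * (d * d + 2 * d * ∑ (filterᵇ b points) μ + 5 * ∑ (filterᵇ b points) (λ p → μ p * μ p)) ∎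
      where
      expand : ∀ d a → (d + 5 * a) * (d + 5 * a) ≡ d * d + 5 * (a * (2 * d + 5 * a))
      expand = solve-∀
      factor : ∀ a b c → a * 5 + 5 * (b + 5 * c) ≡ 5 * (a + b + 5 * c)
      factor = solve-∀

    divide : ∀ a b → 5 * (a + 4 * b) ≡ 5 * a + 20 * b
    divide = solve-∀

  line-weight : ∀ l → c + W l ≡ x + 4 * 𝟙 (L l)
  line-weight l = *-cancelˡ-≡ _ _ 5 (begin
    5 * (c + W l)                     ≡⟨ reduce (λ p → I p l) n m c n≡ (size l) ⟨
    ∑ points (λ p → 𝟙 (I p l) * n p)  ≡⟨ line-sum l ⟩
    5 * x + 20 * 𝟙 (L l)              ≡⟨ divide x (𝟙 (L l)) ⟨
    5 * (x + 4 * 𝟙 (L l))             ∎)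

  line-weight′ : ∀ l → c′ + W′ l ≡ x + 4 * 𝟙 (L l)
  line-weight′ l = *-cancelˡ-≡ _ _ 5 (begin
    5 * (c′ + W′ l)                   ≡⟨ reduce (λ π → J π l) N m′ c′ N≡ (size′ l) ⟨
    ∑ points (λ π → 𝟙 (J π l) * N π)  ≡⟨ line-sum′ l ⟩
    5 * x + 20 * 𝟙 (L l)              ≡⟨ divide x (𝟙 (L l)) ⟨
    5 * (x + 4 * 𝟙 (L l))             ∎)

  weight-squares : ∀ l → L l ≡ false →
    (c * c + 2 * c * W l + 5 * A₂ l) + (c′ * c′ + 2 * c′ * W′ l + 5 * B₂ l) ≡ 2 * (x * x) + 4 * x
  weight-squares l Ll = *-cancelˡ-≡ _ _ 5 (begin
    5 * ((c * c + 2 * c * W l + 5 * A₂ l) + (c′ * c′ + 2 * c′ * W′ l + 5 * B₂ l))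
      ≡⟨ *-distribˡ-+ 5 (c * c + 2 * c * W l + 5 * A₂ l) _ ⟩
    5 * (c * c + 2 * c * W l + 5 * A₂ l) + 5 * (c′ * c′ + 2 * c′ * W′ l + 5 * B₂ l)
      ≡⟨ cong₂ _+_ (sym (reduce² (λ p → I p l) n m c n≡ (size l))) (sym (reduce² (λ π → J π l) N m′ c′ N≡ (size′ l))) ⟩
    ∑ points (λ p → 𝟙 (I p l) * (n p * n p)) + ∑ points (λ π → 𝟙 (J π l) * (N π * N π))
      ≡⟨ square-sum l Ll ⟩
    10 * (x * x) + 20 * x
      ≡⟨ factor x ⟩
    5 * (2 * (x * x) + 4 * x) ∎)
    where
    factor : ∀ x → 10 * (x * x) + 20 * x ≡ 5 * (2 * (x * x) + 4 * x)
    factor = solve-∀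

  pencil-weight : ∀ {p π} → K p π ≡ true → (c′ + 5 * m′ π) + (c + 5 * m p) ≡ x + 5 * pen p π
  pencil-weight {p} {π} pπ = trans (cong₂ _+_ (sym (N≡ π)) (sym (n≡ p))) (pencil-size pπ)

  pen-empty : ∀ {p π} → (∀ l → I p l ≡ true → J π l ≡ true → L l ≡ false) → pen p π ≡ 0
  pen-empty {p} {π} h = trans (∑-cong lines (λ l → vanish (I p l) (J π l) (L l) (h l))) (∑-zero lines)
    where
    vanish : ∀ a b c → (a ≡ true → b ≡ true → c ≡ false) → 𝟙 a * (𝟙 b * 𝟙 c) ≡ 0
    vanish false _     _ _ = refl
    vanish true  false _ _ = refl
    vanish true  true  c h rewrite h refl refl = refl

  -- If all lines of π are class lines, `pen` counts the whole pencil.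
  pen-full : ∀ {p π} → K p π ≡ true → (∀ l → J π l ≡ true → L l ≡ true) → pen p π ≡ 5
  pen-full {p} {π} pπ h = trans (∑-cong lines (λ l → cong (𝟙 (I p l) *_) (keep (J π l) (L l) (h l)))) (pencil pπ)
    where
    keep : ∀ b c → (b ≡ true → c ≡ true) → 𝟙 b * 𝟙 c ≡ 𝟙 b
    keep false _ _ = refl
    keep true  c h rewrite h refl = refl

  inside-exists : 1 ≤ x → ∃ λ l → L l ≡ true
  inside-exists x≥1 = let l , _ , pos = ∑-positive lines (λ l → 𝟙 (L l)) positive in l , 𝟙-true pos
    where
    positive : 1 ≤ ∣L∣
    positive = subst (1 ≤_) (sym cardinality) (≤-trans x≥1 (m≤n*m x 21))

-- Residues modulo 5

module Residues {points lines I J K} (S : Space points lines I J K)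
                (L : LineSet) (x : ℕ) (cl : IsClass lines L x) where
  open PointCounts S L x cl public
  open Counts S L x cl using (pencil-size; pen)
  open OnLine S
  open ≡-Reasoning

  -- Two points lie in a common plane π, and `N π` cancels between their two flag identities. The
  -- pencil terms are added crosswise to avoid subtraction.
  residue-constant : ∀ p q → n p % 5 ≡ n q % 5
  residue-constant p q with π , pπ , qπ ← common-plane p q = begin
    n p % 5                     ≡⟨ [m+kn]%n≡m%n (n p) (pen q π) 5 ⟨
    (n p + pen q π * 5) % 5     ≡⟨ cong (_% 5) (+-cancelˡ-≡ (N π + x) _ _ same) ⟩
    (n q + pen p π * 5) % 5     ≡⟨ [m+kn]%n≡m%n (n q) (pen p π) 5 ⟩
    n q % 5                     ∎
    where
    rearrange : ∀ N x a b → N + x + (a + b * 5) ≡ (N + a) + (x + 5 * b)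
    rearrange = solve-∀
    same : N π + x + (n p + pen q π * 5) ≡ N π + x + (n q + pen p π * 5)
    same = begin
      N π + x + (n p + pen q π * 5)      ≡⟨ rearrange (N π) x (n p) (pen q π) ⟩
      (N π + n p) + (x + 5 * pen q π)    ≡⟨ cong₂ _+_ (pencil-size pπ) (sym (pencil-size qπ)) ⟩
      (x + 5 * pen p π) + (N π + n q)    ≡⟨ +-comm (x + 5 * pen p π) _ ⟩
      (N π + n q) + (x + 5 * pen p π)    ≡⟨ rearrange (N π) x (n q) (pen p π) ⟨
      N π + x + (n q + pen p π * 5)      ∎

  residue : ℕ
  residue = n p₃ % 5

  residue<5 : residue < 5
  residue<5 = m%n<n (n p₃) 5

  decompose : ∀ p → n p ≡ residue + 5 * (n p / 5)
  decompose p = begin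
    n p                      ≡⟨ m≡m%n+[m/n]*n (n p) 5 ⟩
    n p % 5 + n p / 5 * 5    ≡⟨ cong₂ _+_ (residue-constant p p₃) (*-comm (n p / 5) 5) ⟩
    residue + 5 * (n p / 5)  ∎

-- The first test is the flag identity modulo 5. The second is `weight-squares` modulo 5 for a line
-- outside the class, whose weights are `x ∸ c` and `x ∸ c′`; there `c + W l` equals `x`, so the
-- subtraction is exact.
admissible : ℕ → ℕ → ℕ → Bool
admissible x c c′ = ((c + c′) % 5 ≡ᵇ x % 5) ∧
  ((c * c + 2 * c * (x ∸ c) + (c′ * c′ + 2 * c′ * (x ∸ c′))) % 5 ≡ᵇ (2 * (x * x) + 4 * x) % 5)


residues-admissible : ∀ {points lines I J K} (S : Space points lines I J K) L x (cl : IsClass lines L x) → x < 17 →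
  admissible x (Residues.residue S L x cl) (Residues.residue (dual S) L x cl) ≡ true
residues-admissible {I = I} {J} {K} S L x cl x<17 = ∧-intro (≡ᵇ-complete flag-residue) (≡ᵇ-complete square-residue)
  where
  module R = Residues S L x cl
  module R′ = Residues (dual S) L x cl
  module W = Weights S L x cl R.residue R′.residue (λ p → R.n p / 5) (λ π → R′.n π / 5) R.decompose R′.decompose
  open ≡-Reasoning
  c c′ : ℕ
  c  = R.residue
  c′ = R′.residue
  ∧-intro : ∀ {a b} → a ≡ true → b ≡ true → a ∧ b ≡ true
  ∧-intro refl refl = refl
  ≡ᵇ-complete : ∀ {a b} → a ≡ b → (a ≡ᵇ b) ≡ true
  ≡ᵇ-complete {a} {b} h = Equivalence.to T-≡ (≡⇒≡ᵇ a b h)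
  outside-line = W.outside-exists x<17
  l  = proj₁ outside-line
  Ll = proj₂ outside-line
  -- Here `p₃` stands for a plane, chosen arbitrarily, just to obtain some point of `l`; with any
  -- plane π on `l` it forms a flag.
  flag-point = W.meeting-point l p₃
  p = proj₁ flag-point
  flag-plane = OnLine.plane-on S l
  π = proj₁ flag-plane
  shift : ∀ a b c d → (a + b) + (c + d) * 5 ≡ (b + 5 * c) + (a + 5 * d)
  shift = solve-∀
  flag-residue : (c + c′) % 5 ≡ x % 5
  flag-residue = begin
    (c + c′) % 5                                             ≡⟨ [m+kn]%n≡m%n (c + c′) (R′.n π / 5 + R.n p / 5) 5 ⟨
    (c + c′ + (R′.n π / 5 + R.n p / 5) * 5) % 5              ≡⟨ cong (_% 5) (shift c c′ (R′.n π / 5) (R.n p / 5)) ⟩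
    ((c′ + 5 * (R′.n π / 5)) + (c + 5 * (R.n p / 5))) % 5    ≡⟨ cong (_% 5) (W.pencil-weight (W.flag (proj₁ (proj₂ flag-point)) (proj₂ flag-plane))) ⟩
    (x + 5 * W.pen p π) % 5                                  ≡⟨ cong (λ a → (x + a) % 5) (*-comm 5 (W.pen p π)) ⟩
    (x + W.pen p π * 5) % 5                                  ≡⟨ [m+kn]%n≡m%n x (W.pen p π) 5 ⟩
    x % 5                                                    ∎
  difference : ∀ {a b} → a + b ≡ x + 4 * 𝟙 (L l) → b ≡ x ∸ a
  difference {a} {b} h = sym (trans (cong (_∸ a) (sym (trans h (trans (cong (λ k → x + 4 * 𝟙 k) Ll) (+-identityʳ x))))) (m+n∸m≡n a b))
  squares : ℕ → ℕ → ℕ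
  squares V V′ = c * c + 2 * c * V + (c′ * c′ + 2 * c′ * V′)
  collect : ∀ a b d e → (a + b) + (d + e) * 5 ≡ (a + 5 * d) + (b + 5 * e)
  collect = solve-∀
  square-residue : squares (x ∸ c) (x ∸ c′) % 5 ≡ (2 * (x * x) + 4 * x) % 5
  square-residue = begin
    squares (x ∸ c) (x ∸ c′) % 5
      ≡⟨ cong₂ (λ V V′ → squares V V′ % 5) (difference (W.line-weight l)) (difference (W.line-weight′ l)) ⟨
    squares (W.W l) (W.W′ l) % 5
      ≡⟨ [m+kn]%n≡m%n (squares (W.W l) (W.W′ l)) (W.A₂ l + W.B₂ l) 5 ⟨
    (squares (W.W l) (W.W′ l) + (W.A₂ l + W.B₂ l) * 5) % 5
      ≡⟨ cong (_% 5) (trans (collect (c * c + 2 * c * W.W l) (c′ * c′ + 2 * c′ * W.W′ l) (W.A₂ l) (W.B₂ l)) (W.weight-squares l Ll)) ⟩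
    (2 * (x * x) + 4 * x) % 5 ∎

below-five : ∀ {P : ℕ → ℕ → Bool} → allᵇ (upTo 5) (λ a → allᵇ (upTo 5) (P a)) ≡ true →
  ∀ {a b} → a < 5 → b < 5 → P a b ≡ true
below-five {P} h {a} a<5 b<5 =
  allᵇ-sound {f = P a} (allᵇ-sound {f = λ a → allᵇ (upTo 5) (P a)} h (∈-upTo⁺ a<5)) (∈-upTo⁺ b<5)

-- The classes whose point residue is 0; the parameters 5 and 6 = 5 + c′ are treated together as far as possible.
module ZeroResidue {points lines I J K} (S : Space points lines I J K)
                   (L : LineSet) (c′ : ℕ) (cl : IsClass lines L (5 + c′)) (m m′ : Pt → ℕ)
                   (n≡ : ∀ p → PointCounts.n S L (5 + c′) cl p ≡ 5 * m p)
                   (N≡ : ∀ π → PointCounts.n (dual S) L (5 + c′) cl π ≡ c′ + 5 * m′ π)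
                   -- True for 0 and 1; it makes all square sums below linear in `c′`, for instance
                   -- (1 + c′)² = 1 + 3c′.
                   (idem : c′ * c′ ≡ c′) where
  open Weights S L (5 + c′) cl 0 c′ m m′ n≡ N≡ public
  open ≡-Reasoning

  flag-weight : ∀ {p π} → K p π ≡ true → m p + m′ π ≡ 1 + pen p π
  flag-weight {p} {π} pπ = *-cancelˡ-≡ _ _ 5 (+-cancelˡ-≡ c′ _ _ (begin
    c′ + 5 * (m p + m′ π)          ≡⟨ left c′ (m p) (m′ π) ⟩
    (c′ + 5 * m′ π) + 5 * m p      ≡⟨ pencil-weight pπ ⟩
    5 + c′ + 5 * pen p π           ≡⟨ right c′ (pen p π) ⟩
    c′ + 5 * (1 + pen p π)         ∎))
    where
    left : ∀ a b c → a + 5 * (b + c) ≡ (a + 5 * c) + 5 * b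
    left = solve-∀
    right : ∀ a b → 5 + a + 5 * b ≡ a + 5 * (1 + b)
    right = solve-∀

  outside-weight : ∀ l → L l ≡ false → W l ≡ 5 + c′
  outside-weight l Ll = begin
    W l                       ≡⟨ line-weight l ⟩
    5 + c′ + 4 * 𝟙 (L l)      ≡⟨ cong (λ b → 5 + c′ + 4 * 𝟙 b) Ll ⟩
    5 + c′ + 0                ≡⟨ +-identityʳ (5 + c′) ⟩
    5 + c′                    ∎

  inside-weight : ∀ l → L l ≡ true → W l ≡ 9 + c′
  inside-weight l Ll = begin
    W l                       ≡⟨ line-weight l ⟩
    5 + c′ + 4 * 𝟙 (L l)      ≡⟨ cong (λ b → 5 + c′ + 4 * 𝟙 b) Ll ⟩
    5 + c′ + 4                ≡⟨ +-comm (5 + c′) 4 ⟩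
    9 + c′                    ∎

  outside-weight′ : ∀ l → L l ≡ false → W′ l ≡ 5
  outside-weight′ l Ll = +-cancelˡ-≡ c′ _ _ (begin
    c′ + W′ l                 ≡⟨ line-weight′ l ⟩
    5 + c′ + 4 * 𝟙 (L l)      ≡⟨ cong (λ b → 5 + c′ + 4 * 𝟙 b) Ll ⟩
    5 + c′ + 0                ≡⟨ +-identityʳ (5 + c′) ⟩
    5 + c′                    ≡⟨ +-comm 5 c′ ⟩
    c′ + 5                    ∎)

  inside-weight′ : ∀ l → L l ≡ true → W′ l ≡ 9
  inside-weight′ l Ll = +-cancelˡ-≡ c′ _ _ (begin
    c′ + W′ l                 ≡⟨ line-weight′ l ⟩
    5 + c′ + 4 * 𝟙 (L l)      ≡⟨ cong (λ b → 5 + c′ + 4 * 𝟙 b) Ll ⟩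
    5 + c′ + 4                ≡⟨ rearrange c′ ⟩
    c′ + 9                    ∎)
    where
    rearrange : ∀ a → 5 + a + 4 ≡ a + 9
    rearrange = solve-∀

  -- This is `weight-squares` with c = 0 and W′ = 5; the term 11c′ is c′² + 2c′·5.
  outside-squares : ∀ l → L l ≡ false → A₂ l + B₂ l ≡ 14 + 3 * c′
  outside-squares l Ll = *-cancelˡ-≡ _ _ 5 (+-cancelˡ-≡ (11 * c′) _ _ (begin
    11 * c′ + 5 * (A₂ l + B₂ l)
      ≡⟨ left c′ (A₂ l) (B₂ l) ⟩
    5 * A₂ l + (c′ + 2 * c′ * 5 + 5 * B₂ l)
      ≡⟨ cong₂ (λ a b → 5 * A₂ l + (a + 2 * c′ * b + 5 * B₂ l)) (sym idem) (sym (outside-weight′ l Ll)) ⟩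
    5 * A₂ l + (c′ * c′ + 2 * c′ * W′ l + 5 * B₂ l)
      ≡⟨ weight-squares l Ll ⟩
    2 * ((5 + c′) * (5 + c′)) + 4 * (5 + c′)
      ≡⟨ middle c′ ⟩
    70 + 24 * c′ + 2 * (c′ * c′)
      ≡⟨ cong (λ a → 70 + 24 * c′ + 2 * a) idem ⟩
    70 + 24 * c′ + 2 * c′
      ≡⟨ right c′ ⟩
    11 * c′ + 5 * (14 + 3 * c′) ∎))
    where
    left : ∀ c a b → 11 * c + 5 * (a + b) ≡ 5 * a + (c + 2 * c * 5 + 5 * b)
    left = solve-∀
    middle : ∀ c → 2 * ((5 + c) * (5 + c)) + 4 * (5 + c) ≡ 70 + 24 * c + 2 * (c * c)
    middle = solve-∀
    right : ∀ c → 70 + 24 * c + 2 * c ≡ 11 * c + 5 * (14 + 3 * c)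
    right = solve-∀

  -- Five positive weights with sum 5 + c′ leave a surplus of c′.
  outside-positive : ∀ {p} g → (∀ q → 1 ≤ m q) → L g ≡ false → I p g ≡ true → m p ≤ 1 + c′
  outside-positive g pos Lg pg = ≤-excess m c′ (pointsOn-unique g) (λ _ → pos _)
    (≤-reflexive (trans (outside-weight g Lg) (cong (_+ c′) (sym (pointsOn-length g))))) (pointsOn⁺ g pg)

  outside-positive′ : ∀ g → (∀ {π} → J π g ≡ true → 1 ≤ m′ π) → L g ≡ false → ∀ {π} → J π g ≡ true → m′ π ≡ 1
  outside-positive′ g pos Lg πg = all-ones m′ (planesOn-unique g) (λ π∈ → pos (planesOn⁻ g π∈))
    (trans (outside-weight′ g Lg) (sym (planesOn-length g))) (planesOn⁺ g πg)

  -- As a multiple of 5 that is at most 21, `n p` is at most 20, so some line through `p` is outside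
  -- the class.
  point-outside : ∀ p → ∃ λ l → I p l ≡ true × L l ≡ false
  point-outside p = outside-line p (subst (_< 21) (sym (n≡ p)) (s≤s (*-monoʳ-≤ 5 m≤4)))
    where
    m≤4 : m p ≤ 4
    m≤4 = s≤s⁻¹ (*-cancelˡ-< 5 (m p) 5 (≤-<-trans (subst (_≤ 21) (n≡ p) (n≤21 p)) (m≤m+n 22 3)))

  module ZeroPoint {p : Pt} (mp≡0 : m p ≡ 0) where

    outside-through : ∀ {h} → I p h ≡ true → L h ≡ false
    outside-through = outside (trans (n≡ p) (cong (5 *_) mp≡0))

    positive-plane : ∀ {π} → K p π ≡ true → 1 ≤ m′ π
    positive-plane {π} pπ = subst (1 ≤_) (trans (sym (flag-weight pπ)) (cong (_+ m′ π) mp≡0)) (s≤s z≤n)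

    -- Each plane on `h` contains `p` and so has positive weight. Five positive weights with sum 5
    -- are all 1, which takes 5 from the total 14 + 3c′.
    squares-through : ∀ {h} → I p h ≡ true → A₂ h ≡ 9 + 3 * c′
    squares-through {h} ph = +-cancelʳ-≡ 5 _ _ (begin
      A₂ h + 5            ≡⟨ cong (A₂ h +_) (sym squares′) ⟩
      A₂ h + B₂ h         ≡⟨ outside-squares h (outside-through ph) ⟩
      14 + 3 * c′         ≡⟨ +-comm 5 (9 + 3 * c′) ⟩
      9 + 3 * c′ + 5      ∎)
      where
      squares′ : B₂ h ≡ 5
      squares′ = trans (ones-squared (planesOn h) m′ (λ π∈ → outside-positive′ h
          (λ πh → positive-plane (flag ph πh)) (outside-through ph) (planesOn⁻ h π∈)))
        (planesOn-length h)

    -- The other two weights u, v on such a line would satisfy u + v = 3 and u² + v² = 7.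
    no-triple : ∀ {h q z} → I p h ≡ true → I q h ≡ true → I z h ≡ true →
      m q ≡ 1 + c′ → m z ≡ 1 → q ≢ z → ⊥
    no-triple {h} {q} {z} ph qh zh mq mz q≢z = no-pair (m u) (m v) linear quadratic
      where
      distinct : ∀ {y k} → m y ≡ suc k → p ≢ y
      distinct my refl = contradiction (trans (sym mp≡0) my) λ ()
      decomposition = triple-with-rest (pointsOn-unique h) (pointsOn-length h) (pointsOn⁺ h ph) (pointsOn⁺ h qh) (pointsOn⁺ h zh)
        (distinct mq) (distinct mz) q≢z
      u = proj₁ decomposition
      v = proj₁ (proj₂ decomposition)
      sum : ∀ f → ∑ (pointsOn h) f ≡ f p + (f q + (f z + (f u + (f v + 0))))
      sum = proj₂ (proj₂ decomposition)
      linear : m u + m v ≡ 3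
      linear = +-cancelˡ-≡ (2 + c′) _ _ (begin
        2 + c′ + (m u + m v)                          ≡⟨ shape c′ (m u) (m v) ⟩
        0 + (1 + c′ + (1 + (m u + (m v + 0))))        ≡⟨ cong₂ (λ a b → a + (b + (1 + (m u + (m v + 0))))) (sym mp≡0) (sym mq) ⟩
        m p + (m q + (1 + (m u + (m v + 0))))         ≡⟨ cong (λ a → m p + (m q + (a + (m u + (m v + 0))))) (sym mz) ⟩
        m p + (m q + (m z + (m u + (m v + 0))))       ≡⟨ sum m ⟨
        W h                                           ≡⟨ outside-weight h (outside-through ph) ⟩
        5 + c′                                        ≡⟨ +-comm 3 (2 + c′) ⟩
        2 + c′ + 3                                    ∎)
        where
        shape : ∀ c a b → 2 + c + (a + b) ≡ 0 + (1 + c + (1 + (a + (b + 0))))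
        shape = solve-∀
      quadratic : m u * m u + m v * m v ≡ 7
      quadratic = +-cancelˡ-≡ (2 + 3 * c′) _ _ (begin
        2 + 3 * c′ + (m u * m u + m v * m v)
          ≡⟨ cong (λ a → 2 + (a + 2 * c′) + (m u * m u + m v * m v)) (sym idem) ⟩
        2 + (c′ * c′ + 2 * c′) + (m u * m u + m v * m v)
          ≡⟨ shape c′ (m u * m u) (m v * m v) ⟩
        0 * 0 + ((1 + c′) * (1 + c′) + (1 * 1 + (m u * m u + (m v * m v + 0))))
          ≡⟨ cong₂ (λ a b → a * a + (b * b + (1 * 1 + (m u * m u + (m v * m v + 0))))) (sym mp≡0) (sym mq) ⟩
        m p * m p + (m q * m q + (1 * 1 + (m u * m u + (m v * m v + 0))))
          ≡⟨ cong (λ a → m p * m p + (m q * m q + (a * a + (m u * m u + (m v * m v + 0))))) (sym mz) ⟩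
        m p * m p + (m q * m q + (m z * m z + (m u * m u + (m v * m v + 0))))
          ≡⟨ sum (λ y → m y * m y) ⟨
        A₂ h
          ≡⟨ squares-through ph ⟩
        9 + 3 * c′
          ≡⟨ +-comm 7 (2 + 3 * c′) ⟩
        2 + 3 * c′ + 7 ∎)
        where
        shape : ∀ c a b → 2 + (c * c + 2 * c) + (a + b) ≡ 0 + ((1 + c) * (1 + c) + (1 + (a + (b + 0))))
        shape = solve-∀

-- Parameter 5

module Five {points lines I J K} (S : Space points lines I J K)
            (L : LineSet) (cl : IsClass lines L 5) (m m′ : Pt → ℕ)
            (n≡ : ∀ p → PointCounts.n S L 5 cl p ≡ 5 * m p)
            (N≡ : ∀ π → PointCounts.n (dual S) L 5 cl π ≡ 5 * m′ π) where
  open ZeroResidue S L 0 cl m m′ n≡ N≡ refl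

  -- If all weights were positive, the five on a line outside the class would be 1. Every point lies
  -- on such a line, so a class line would weigh 5 instead of 9.
  zero-point : (∀ p → 1 ≤ m p) → ⊥
  zero-point pos = contradiction (begin
    9               ≡⟨ inside-weight l Ll ⟨
    W l             ≤⟨ ∑-bound (pointsOn l) m 1 (λ {p} _ → m≤1 p) ⟩
    length (pointsOn l) * 1 ≡⟨ cong (_* 1) (pointsOn-length l) ⟩
    5               ∎) (<⇒≱ (m≤m+n 6 3))
    where
    open ≤-Reasoning
    m≤1 : ∀ p → m p ≤ 1
    m≤1 p = let g , pg , Lg = point-outside p in outside-positive g pos Lg pg
    inside = inside-exists (s≤s z≤n)
    l  = proj₁ inside
    Ll = proj₂ inside

  -- The point and the plane need not be incident. All points of a plane of weight 0 have weight 1,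
  -- and a line of π lies in a second such plane ρ, so a line from `p` to a point of ρ off π meets
  -- two points of weight 1.
  zero-flag : ∀ p π → m p ≡ 0 → m′ π ≡ 0 → ⊥
  zero-flag p π mp≡0 m′π≡0 = no-triple ph rh zh (ones m′ρ≡0 rρ) (ones m′π≡0 zπ)
    (λ r≡z → contradiction (trans (sym (subst (λ y → K y π ≡ true) (sym r≡z) zπ)) r∉π) λ ())
    where
    open ZeroPoint mp≡0
    outside-in : ∀ {π} → m′ π ≡ 0 → ∀ {l} → J π l ≡ true → L l ≡ false
    outside-in {π} m′π = outside′ (trans (N≡ π) (cong (5 *_) m′π))
    ones : ∀ {π q} → m′ π ≡ 0 → K q π ≡ true → m q ≡ 1
    ones {π} {q} m′π qπ = trans (sym (+-identityʳ (m q))) (trans (cong (m q +_) (sym m′π))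
      (trans (flag-weight qπ) (cong suc (pen-empty (λ l _ πl → outside-in m′π πl)))))
    line = outside-line′ π (subst (_< 21) (sym (trans (N≡ π) (cong (5 *_) m′π≡0))) (s≤s z≤n))
    g  = proj₁ line
    πg = proj₁ (proj₂ line)
    Lg = proj₂ (proj₂ line)
    open Removal (remove (planesOn-unique g) (planesOn⁺ g πg))
    squares′ : B₂ g ≡ 9
    squares′ = +-cancelˡ-≡ 5 _ _ (trans (cong (_+ B₂ g) (sym squares)) (outside-squares g Lg))
      where
      squares : A₂ g ≡ 5
      squares = trans (ones-squared (pointsOn g) m (λ q∈ → ones m′π≡0 (flag (pointsOn⁻ g q∈) πg))) (pointsOn-length g)
    rest-weight : ∑ rest m′ ≡ 5
    rest-weight = trans (cong (_+ ∑ rest m′) (sym m′π≡0)) (trans (sym (sum m′)) (outside-weight′ g Lg))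
    rest-squares : ∑ rest (λ ρ → m′ ρ * m′ ρ) ≡ 9
    rest-squares = trans (cong (λ a → a * a + ∑ rest (λ ρ → m′ ρ * m′ ρ)) (sym m′π≡0)) (trans (sym (sum _)) squares′)
    rest-length : length rest ≡ 4
    rest-length = suc-injective (trans (sym size-on) (planesOn-length g))
      where size-on = Removal.size (remove (planesOn-unique g) (planesOn⁺ g πg))
    -- Four positive weights with sum 5 are 2, 1, 1, 1.
    not-all-positive : (∀ {ρ} → ρ ∈ rest → 1 ≤ m′ ρ) → ⊥
    not-all-positive pos = contradiction (begin
      9 + length rest * 2                                ≡⟨ cong₂ _+_ rest-squares (∑-const rest 2) ⟨
      ∑ rest (λ ρ → m′ ρ * m′ ρ) + ∑ rest (λ _ → 2)      ≡⟨ sym (∑-+ rest _ _) ⟩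
      ∑ rest (λ ρ → m′ ρ * m′ ρ + 2)                     ≡⟨ ∑-cong∈ rest (λ {ρ} ρ∈ → one-or-two (m′ ρ) (pos ρ∈) (at-most-two ρ∈)) ⟩
      ∑ rest (λ ρ → 3 * m′ ρ)                            ≡⟨ ∑-*ˡ rest 3 m′ ⟩
      3 * ∑ rest m′                                      ≡⟨ cong (3 *_) rest-weight ⟩
      15                                                 ∎) (λ h → contradiction (trans (cong (λ k → 9 + k * 2) (sym rest-length)) h) λ ())
      where
      open ≡-Reasoning
      at-most-two : ∀ {ρ} → ρ ∈ rest → m′ ρ ≤ 2
      at-most-two ρ∈ = ≤-excess m′ 1 unique pos (≤-reflexive (trans rest-weight (cong (_+ 1) (sym rest-length)))) ρ∈
      -- 1 and 2 are the roots of a² + 2 = 3a; four such weights with sum 5 have square sum 15 - 8 =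
      -- 7, whereas 9 is required.
      one-or-two : ∀ a → 1 ≤ a → a ≤ 2 → a * a + 2 ≡ 3 * a
      one-or-two 1 _ _ = refl
      one-or-two 2 _ _ = refl
      one-or-two (suc (suc (suc _))) _ (s≤s (s≤s ()))
    second : ∃ λ ρ → ρ ∈ rest × m′ ρ ≡ 0
    second = pick (search (zero-or-positive m′) rest)
      where
      pick : (∃ λ ρ → ρ ∈ rest × m′ ρ ≡ 0) ⊎ (∀ {ρ} → ρ ∈ rest → 1 ≤ m′ ρ) → ∃ λ ρ → ρ ∈ rest × m′ ρ ≡ 0
      pick (inj₁ found) = found
      pick (inj₂ pos)   = ⊥-elim (not-all-positive pos)
    ρ = proj₁ second
    m′ρ≡0 = proj₂ (proj₂ second)
    -- Taking `r` in ρ but off π ensures that the line `h` from `p` to `r` meets π in a point `z`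
    -- other than `r`.
    separated = separate π ρ (removed (proj₁ (proj₂ second)))
    r   = proj₁ separated
    rρ  = proj₁ (proj₂ separated)
    r∉π = proj₂ (proj₂ separated)
    joined = joining-line p r
    h  = proj₁ joined
    ph = proj₁ (proj₂ joined)
    rh = proj₂ (proj₂ joined)
    met = meeting-point h π
    z  = proj₁ met
    zh = proj₁ (proj₂ met)
    zπ = proj₂ (proj₂ met)

no-class-five : ∀ {points lines I J K} (S : Space points lines I J K) (L : LineSet) (cl : IsClass lines L 5) (m m′ : Pt → ℕ) →
  (∀ p → PointCounts.n S L 5 cl p ≡ 5 * m p) → (∀ π → PointCounts.n (dual S) L 5 cl π ≡ 5 * m′ π) → ⊥
no-class-five S L cl m m′ n≡ N≡ =
  Five.zero-point (dual S) L cl m′ m N≡ n≡ λ π → n≢0⇒n>0 λ m′π≡0 →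
  F.zero-point λ p → n≢0⇒n>0 λ mp≡0 → F.zero-flag p π mp≡0 m′π≡0
  where module F = Five S L cl m m′ n≡ N≡

-- Parameter 6

module Six {points lines I J K} (S : Space points lines I J K)
           (L : LineSet) (cl : IsClass lines L 6) (m m′ : Pt → ℕ)
           (n≡ : ∀ p → PointCounts.n S L 6 cl p ≡ 5 * m p)
           (N≡ : ∀ π → PointCounts.n (dual S) L 6 cl π ≡ 1 + 5 * m′ π) where
  open ZeroResidue S L 1 cl m m′ n≡ N≡ refl

  m′≤4 : ∀ π → m′ π ≤ 4
  m′≤4 π = *-cancelˡ-≤ 5 (s≤s⁻¹ (subst (_≤ 21) (N≡ π) (N≤21 π)))

  -- Weight 4 means `N π` = 21, that is, all lines of π; any smaller weight gives at most 16.
  plane-outside : ∀ π → m′ π ≤ 3 → ∃ λ l → J π l ≡ true × L l ≡ false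
  plane-outside π m′≤3 = outside-line′ π (subst (_< 21) (sym (N≡ π)) (≤-trans (s≤s (s≤s (*-monoʳ-≤ 5 m′≤3))) (m≤m+n 17 4)))

  inside = inside-exists (s≤s z≤n)

  -- Without a point of weight 0 all weights would be 2.
  zero-point : (∀ p → 1 ≤ m p) → ⊥
  zero-point pos = contradiction (begin
    5 * 2                     ≡⟨ cong (_* 2) (pointsOn-length g) ⟨
    length (pointsOn g) * 2   ≡⟨ ∑-const (pointsOn g) 2 ⟨
    ∑ (pointsOn g) (λ _ → 2)  ≤⟨ ∑-mono∈ (pointsOn g) (λ {p} _ → 2≤m p) ⟩
    W g                       ≡⟨ outside-weight g Lg ⟩
    6                         ∎) (<⇒≱ (m≤m+n 7 3))
    where
    open ≤-Reasoning
    m≤2 : ∀ p → m p ≤ 2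
    m≤2 p = let g , pg , Lg = point-outside p in outside-positive g pos Lg pg
    outside-g = point-outside p₃
    g  = proj₁ outside-g
    Lg = proj₂ (proj₂ outside-g)
    -- As `n p` is at least 5, some class line passes through `p`. It weighs 10 and its other four
    -- points at most 8.
    2≤m : ∀ p → 2 ≤ m p
    2≤m p = +-cancelʳ-≤ 8 2 (m p) (begin
      10                       ≡⟨ inside-weight l Ll ⟨
      W l                      ≡⟨ sum m ⟩
      m p + ∑ rest m           ≤⟨ +-monoʳ-≤ (m p) (∑-bound rest m 2 (λ {q} _ → m≤2 q)) ⟩
      m p + length rest * 2    ≡⟨ cong (λ k → m p + k * 2) (suc-injective (trans (sym size-on) (pointsOn-length l))) ⟩
      m p + 8                  ∎)
      where
      through-p = inside-line p (subst (1 ≤_) (sym (n≡ p)) (≤-trans (pos p) (m≤n*m (m p) 5)))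
      l  = proj₁ through-p
      Ll = proj₂ (proj₂ through-p)
      removal = remove (pointsOn-unique l) (pointsOn⁺ l (proj₁ (proj₂ through-p)))
      open Removal removal
      size-on = Removal.size removal

  -- Without a plane of weight 0 all planes would have weight 1 or 4, and 9 is not a sum of five such weights.
  zero-plane : (∀ π → 1 ≤ m′ π) → ⊥
  zero-plane pos = impossible (∑ (planesOn l) (λ π → 𝟙 (m′ π ≡ᵇ 4))) (begin
    5 + 3 * ∑ (planesOn l) (λ π → 𝟙 (m′ π ≡ᵇ 4))
      ≡⟨ cong₂ _+_ (sym (trans (∑-const (planesOn l) 1) (cong (_* 1) (planesOn-length l)))) (sym (∑-*ˡ (planesOn l) 3 _)) ⟩
    ∑ (planesOn l) (λ _ → 1) + ∑ (planesOn l) (λ π → 3 * 𝟙 (m′ π ≡ᵇ 4))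
      ≡⟨ sym (∑-+ (planesOn l) _ _) ⟩
    ∑ (planesOn l) (λ π → 1 + 3 * 𝟙 (m′ π ≡ᵇ 4))
      ≡⟨ ∑-cong (planesOn l) (λ π → one-or-four (m′ π) (m′≤4 π) (small π)) ⟩
    W′ l
      ≡⟨ inside-weight′ l Ll ⟩
    9 ∎)
    where
    open ≡-Reasoning
    l  = proj₁ inside
    Ll = proj₂ inside
    -- Such a plane contains a line outside the class, whose five positive plane weights have sum 5.
    small : ∀ π → m′ π ≤ 3 → m′ π ≡ 1
    small π m′≤3 = let g , πg , Lg = plane-outside π m′≤3 in outside-positive′ g (λ _ → pos _) Lg πg
    one-or-four : ∀ a → a ≤ 4 → (a ≤ 3 → a ≡ 1) → 1 + 3 * 𝟙 (a ≡ᵇ 4) ≡ a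
    one-or-four 0 _ h = contradiction (h z≤n) λ ()
    one-or-four 1 _ h = refl
    one-or-four 2 _ h = contradiction (h (m≤m+n 2 1)) λ ()
    one-or-four 3 _ h = contradiction (h ≤-refl) λ ()
    one-or-four 4 _ h = refl
    one-or-four (suc (suc (suc (suc (suc _))))) (s≤s (s≤s (s≤s (s≤s ())))) _
    impossible : ∀ k → 5 + 3 * k ≡ 9 → ⊥
    impossible 0 ()
    impossible 1 ()
    impossible (suc (suc k)) e = contradiction (subst (11 ≤_) e (+-monoʳ-≤ 5 (*-monoʳ-≤ 3 (m≤m+n 2 k)))) (<⇒≱ (m≤m+n 10 1))

  -- On a line of σ outside the class, the point weights have sum 6, hence square sum at least 8,
  -- and σ contributes 9. This exhausts the total 17, although the other four planes still have
  -- weight 2 to share.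
  weight-three : ∀ σ → m′ σ ≡ 3 → ⊥
  weight-three σ m′σ = contradiction (begin
    2                                          ≡⟨ rest-weight ⟨
    ∑ rest m′                                  ≤⟨ ∑-mono∈ rest (λ {ρ} _ → n≤n² (m′ ρ)) ⟩
    ∑ rest (λ ρ → m′ ρ * m′ ρ)                 ≤⟨ rest-squares ⟩
    0                                          ∎) λ ()
    where
    open ≤-Reasoning
    outside-g = plane-outside σ (≤-reflexive m′σ)
    g  = proj₁ outside-g
    σg = proj₁ (proj₂ outside-g)
    Lg = proj₂ (proj₂ outside-g)
    open Removal (remove (planesOn-unique g) (planesOn⁺ g σg))
    n≤n² : ∀ k → k ≤ k * k
    n≤n² zero    = z≤n
    n≤n² (suc k) = m≤m*n (suc k) (suc k)
    rest-weight : ∑ rest m′ ≡ 2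
    rest-weight = +-cancelˡ-≡ 3 _ _ (trans (cong (_+ ∑ rest m′) (sym m′σ)) (trans (sym (sum m′)) (outside-weight′ g Lg)))
    -- This is (a - 1)(a - 2) ≥ 0, with equality at the balanced weights 1, 1, 1, 1, 2.
    convex : ∀ a → 3 * a ≤ a * a + 2
    convex 0 = z≤n
    convex 1 = ≤-refl
    convex 2 = ≤-refl
    convex a@(suc (suc (suc k))) = ≤-trans (*-monoˡ-≤ a (m≤m+n 3 k)) (m≤m+n (a * a) 2)
    squares≥8 : 8 ≤ A₂ g
    squares≥8 = +-cancelʳ-≤ 10 8 (A₂ g) (begin
      18                                             ≡⟨ cong (3 *_) (outside-weight g Lg) ⟨
      3 * W g                                        ≡⟨ ∑-*ˡ (pointsOn g) 3 m ⟨
      ∑ (pointsOn g) (λ p → 3 * m p)                 ≤⟨ ∑-mono∈ (pointsOn g) (λ {p} _ → convex (m p)) ⟩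
      ∑ (pointsOn g) (λ p → m p * m p + 2)           ≡⟨ ∑-+ (pointsOn g) _ _ ⟩
      A₂ g + ∑ (pointsOn g) (λ _ → 2)                ≡⟨ cong (A₂ g +_) (trans (∑-const (pointsOn g) 2) (cong (_* 2) (pointsOn-length g))) ⟩
      A₂ g + 10                                      ∎)
    rest-squares : ∑ rest (λ ρ → m′ ρ * m′ ρ) ≤ 0
    rest-squares = +-cancelˡ-≤ 17 _ 0 (begin
      8 + (3 * 3 + ∑ rest (λ ρ → m′ ρ * m′ ρ))         ≡⟨ cong (λ a → 8 + (a * a + ∑ rest (λ ρ → m′ ρ * m′ ρ))) m′σ ⟨
      8 + (m′ σ * m′ σ + ∑ rest (λ ρ → m′ ρ * m′ ρ))   ≡⟨ cong (8 +_) (sum (λ ρ → m′ ρ * m′ ρ)) ⟨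
      8 + B₂ g                                         ≤⟨ +-monoˡ-≤ (B₂ g) squares≥8 ⟩
      A₂ g + B₂ g                                      ≡⟨ outside-squares g Lg ⟩
      17                                               ∎)

  module FullPlane {σ : Pt} (m′σ : m′ σ ≡ 4) where

    all-inside : ∀ l → J σ l ≡ true → L l ≡ true
    all-inside l = full′ (trans (N≡ σ) (cong (λ a → 1 + 5 * a) m′σ))

    -- Every pencil in σ consists of five class lines, so `flag-weight` reads m q + 4 = 1 + 5.
    weight-two : ∀ {q} → K q σ ≡ true → m q ≡ 2
    weight-two {q} qσ = +-cancelʳ-≡ 4 _ _ (begin
      m q + 4        ≡⟨ cong (m q +_) m′σ ⟨
      m q + m′ σ     ≡⟨ flag-weight qσ ⟩
      1 + pen q σ    ≡⟨ cong suc (pen-full qσ all-inside) ⟩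
      6              ∎)
      where open ≡-Reasoning

  module UnitPlane {π : Pt} (m′π≡0 : m′ π ≡ 0) where

    N≡1 : N π ≡ 1
    N≡1 = trans (N≡ π) (cong (λ a → 1 + 5 * a) m′π≡0)

    class-line : ∃ λ l → J π l ≡ true × L l ≡ true
    class-line = inside-line′ π (≤-reflexive (sym N≡1))

    l₀ : Line
    l₀ = proj₁ class-line

    -- As `l₀` is the only class line in π, a pencil in π at a point off `l₀` has none.
    weight-one : ∀ {z} → K z π ≡ true → I z l₀ ≡ false → m z ≡ 1
    weight-one {z} zπ z∉l₀ = begin
      m z            ≡⟨ trans (sym (+-identityʳ (m z))) (cong (m z +_) (sym m′π≡0)) ⟩
      m z + m′ π     ≡⟨ flag-weight zπ ⟩
      1 + pen z π    ≡⟨ cong suc (pen-empty other-lines) ⟩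
      1              ∎
      where
      open ≡-Reasoning
      other-lines : ∀ l → I z l ≡ true → J π l ≡ true → L l ≡ false
      other-lines l zl πl = outside-other′ l₀ l N≡1 (proj₁ (proj₂ class-line)) (proj₂ (proj₂ class-line)) πl
        (λ l₀≡l → contradiction (trans (sym zl) (subst (λ k → I z k ≡ false) l₀≡l z∉l₀)) λ ())

    -- The four planes on `l₀` other than π share the weight 9. Weight 3 is excluded, so without a
    -- plane of weight 4 they would reach at most 8.
    heavy-plane : ∃ λ σ → J σ l₀ ≡ true × π ≢ σ × m′ σ ≡ 4
    heavy-plane = pick (search heavy-or-light rest)
      where
      removal = remove (planesOn-unique l₀) (planesOn⁺ l₀ (proj₁ (proj₂ class-line)))
      open Removal removal
      size-on = Removal.size removal
      heavy-or-light : ∀ σ → m′ σ ≡ 4 ⊎ m′ σ ≤ 2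
      heavy-or-light σ = cases (m′ σ) (m′≤4 σ) (weight-three σ)
        where
        cases : ∀ a → a ≤ 4 → (a ≡ 3 → ⊥) → a ≡ 4 ⊎ a ≤ 2
        cases 0 _ _ = inj₂ z≤n
        cases 1 _ _ = inj₂ (s≤s z≤n)
        cases 2 _ _ = inj₂ ≤-refl
        cases 3 _ h = ⊥-elim (h refl)
        cases 4 _ _ = inj₁ refl
        cases (suc (suc (suc (suc (suc _))))) (s≤s (s≤s (s≤s (s≤s ())))) _
      rest-weight : ∑ rest m′ ≡ 9
      rest-weight = trans (cong (_+ ∑ rest m′) (sym m′π≡0)) (trans (sym (sum m′)) (inside-weight′ l₀ (proj₂ (proj₂ class-line))))
      pick : (∃ λ σ → σ ∈ rest × m′ σ ≡ 4) ⊎ (∀ {σ} → σ ∈ rest → m′ σ ≤ 2) → ∃ λ σ → J σ l₀ ≡ true × π ≢ σ × m′ σ ≡ 4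
      pick (inj₁ (σ , σ∈ , m′σ)) = σ , planesOn⁻ l₀ (⊆ σ∈) , removed σ∈ , m′σ
      pick (inj₂ light) = contradiction
        (subst₂ _≤_ rest-weight (cong (_* 2) (suc-injective (trans (sym size-on) (planesOn-length l₀)))) (∑-bound rest m′ 2 light))
        (<⇒≱ (n<1+n 8))

  -- Here the second plane is the heavy plane σ on the class line `l₀` of π: the line from `p` to a
  -- point `r` of σ off π has weight 2 at `r` and weight 1 where it meets π.
  zero-flag : ∀ p π → m p ≡ 0 → m′ π ≡ 0 → ⊥
  zero-flag p π mp≡0 m′π≡0 = no-triple ph rh zh (weight-two rσ) (weight-one zπ z∉l₀) r≢z
    where
    open ZeroPoint mp≡0
    open UnitPlane m′π≡0
    σ  = proj₁ heavy-plane
    σl = proj₁ (proj₂ heavy-plane)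
    open FullPlane (proj₂ (proj₂ (proj₂ heavy-plane)))
    separated = separate π σ (proj₁ (proj₂ (proj₂ heavy-plane)))
    r   = proj₁ separated
    rσ  = proj₁ (proj₂ separated)
    r∉π = proj₂ (proj₂ separated)
    joined = joining-line p r
    h  = proj₁ joined
    ph = proj₁ (proj₂ joined)
    rh = proj₂ (proj₂ joined)
    met = meeting-point h π
    z  = proj₁ met
    zh = proj₁ (proj₂ met)
    zπ = proj₂ (proj₂ met)
    r≢z : r ≢ z
    r≢z r≡z = contradiction (trans (sym (subst (λ y → K y π ≡ true) (sym r≡z) zπ)) r∉π) λ ()
    -- Otherwise `z` and `r` are two points of `h` in σ, so `h` and with it `p` lie in σ, where all
    -- weights are 2.
    z∉l₀ : I z l₀ ≡ false
    z∉l₀ = decide (I z l₀) λ zl → contradiction (trans (sym mp≡0) (weight-two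
      (flag ph (line-in-plane r≢z rh zh rσ (flag zl σl))))) λ ()
      where
      decide : ∀ b → (b ≡ true → ⊥) → b ≡ false
      decide false _ = refl
      decide true  h = ⊥-elim (h refl)

no-class-six : ∀ {points lines I J K} (S : Space points lines I J K) (L : LineSet) (cl : IsClass lines L 6) (m m′ : Pt → ℕ) →
  (∀ p → PointCounts.n S L 6 cl p ≡ 5 * m p) → (∀ π → PointCounts.n (dual S) L 6 cl π ≡ 1 + 5 * m′ π) → ⊥
no-class-six S L cl m m′ n≡ N≡ =
  zero-plane λ π → n≢0⇒n>0 λ m′π≡0 → zero-point λ p → n≢0⇒n>0 λ mp≡0 → zero-flag p π mp≡0 m′π≡0
  where open Six S L cl m m′ n≡ N≡

-- The four parameters

module ResidueCases {points lines I J K} (S : Space points lines I J K)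
                    (L : LineSet) (x : ℕ) (cl : IsClass lines L x) (x<17 : x < 17) where
  module R  = Residues S L x cl
  module R′ = Residues (dual S) L x cl

  m m′ : Pt → ℕ
  m p  = R.n p / 5
  m′ π = R′.n π / 5

  -- The premise is decided by evaluating all 25 pairs of residues. Where no pair is admissible,
  -- even the constant `false` satisfies it, which gives the contradiction.
  residues-satisfy : ∀ (P : ℕ → ℕ → Bool) →
    allᵇ (upTo 5) (λ c → allᵇ (upTo 5) (λ c′ → if admissible x c c′ then P c c′ else true)) ≡ true →
    P R.residue R′.residue ≡ true
  residues-satisfy P h =
    subst (λ b → (if b then P R.residue R′.residue else true) ≡ true) (residues-admissible S L x cl x<17)
      (below-five {P = λ c c′ → if admissible x c c′ then P c c′ else true} h R.residue<5 R′.residue<5)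

  decompose-as : ∀ c → R.residue ≡ c → ∀ p → R.n p ≡ c + 5 * m p
  decompose-as c e p = trans (R.decompose p) (cong (_+ 5 * m p) e)

  decompose-as′ : ∀ c → R′.residue ≡ c → ∀ π → R′.n π ≡ c + 5 * m′ π
  decompose-as′ c e π = trans (R′.decompose π) (cong (_+ 5 * m′ π) e)

module _ {points lines I J K} (S : Space points lines I J K) (L : LineSet) where

  no-class-of-parameter-4 : ¬ IsClass lines L 4
  no-class-of-parameter-4 cl = contradiction (residues-satisfy (λ _ _ → false) refl) λ ()
    where open ResidueCases S L 4 cl (m≤m+n 5 12)

  no-class-of-parameter-8 : ¬ IsClass lines L 8
  no-class-of-parameter-8 cl = contradiction (residues-satisfy (λ _ _ → false) refl) λ ()
    where open ResidueCases S L 8 cl (m≤m+n 9 8)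

  no-class-of-parameter-5 : ¬ IsClass lines L 5
  no-class-of-parameter-5 cl = no-class-five S L cl m m′
    (decompose-as 0 (≡ᵇ-sound (proj₁ both-zero))) (decompose-as′ 0 (≡ᵇ-sound (proj₂ both-zero)))
    where
    open ResidueCases S L 5 cl (m≤m+n 6 11)
    both-zero : (R.residue ≡ᵇ 0) ≡ true × (R′.residue ≡ᵇ 0) ≡ true
    both-zero = ∧-split (residues-satisfy (λ c c′ → (c ≡ᵇ 0) ∧ (c′ ≡ᵇ 0)) refl)

  no-class-of-parameter-6 : ¬ IsClass lines L 6
  no-class-of-parameter-6 cl = cases R.residue R′.residue refl refl (residues-satisfy zero-and-one refl)
    where
    open ResidueCases S L 6 cl (m≤m+n 7 10)
    zero-and-one : ℕ → ℕ → Bool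
    zero-and-one 0 1 = true
    zero-and-one 1 0 = true
    zero-and-one _ _ = false
    cases : ∀ c c′ → R.residue ≡ c → R′.residue ≡ c′ → zero-and-one c c′ ≡ true → ⊥
    cases 0 1 e e′ _ = no-class-six S L cl m m′ (decompose-as 0 e) (decompose-as′ 1 e′)
    cases 1 0 e e′ _ = no-class-six (dual S) L cl m′ m (decompose-as′ 0 e′) (decompose-as 1 e)

open import Data.Integer using (ℤ; +_)
import Data.Integer as ℤ
import Data.Integer.Properties as ℤ

-- The filtered list of the definition becomes a sum of indicators, and the integer equation between
-- nonnegative numbers becomes one of naturals.
toIsClass : ∀ L k → IsCameronLieblerLineClass L (+ k) → IsClass allLines L k
toIsClass L k cl l = trans (trans (∑-cong allLines (λ m → 𝟙-∧ (L m) (not (m ==L l) ∧ meets m l)))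
    (sym (length-filterᵇ allLines (λ m → L m ∧ not (m ==L l) ∧ meets m l))))
  (ℤ.+-injective (trans (cl l) (cong₂ ℤ._+_ (sym (ℤ.pos-* 5 k)) (sym (ℤ.pos-* 15 (𝟙 (L l)))))))
  where
  𝟙-∧ : ∀ a b → 𝟙 b * 𝟙 a ≡ 𝟙 (a ∧ b)
  𝟙-∧ true  b = *-identityʳ (𝟙 b)
  𝟙-∧ false b = *-zeroʳ (𝟙 b)

theorem1 : (x : ℤ) → (x ≡ + 4 ⊎ x ≡ + 5 ⊎ x ≡ + 6 ⊎ x ≡ + 8) →
    ¬ ∃ (λ (L : LineSet) → IsCameronLieblerLineClass L x)
theorem1 _ (inj₁ refl)               (L , cl) = no-class-of-parameter-4 (Verified.space PG34) L (toIsClass L 4 cl)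
theorem1 _ (inj₂ (inj₁ refl))        (L , cl) = no-class-of-parameter-5 (Verified.space PG34) L (toIsClass L 5 cl)
theorem1 _ (inj₂ (inj₂ (inj₁ refl))) (L , cl) = no-class-of-parameter-6 (Verified.space PG34) L (toIsClass L 6 cl)
theorem1 _ (inj₂ (inj₂ (inj₂ refl))) (L , cl) = no-class-of-parameter-8 (Verified.space PG34) L (toIsClass L 8 cl)
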